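{- Consider the pile game with boundary with target $n\ge 1$ and a finite set of choices $R\subset\mathbb{Z}$ with given transition probabilities, played by two or more players. For any initial numbers of chips, the winning and the losing probability generating functions are rational functions of $x$. Hence, if the transition probabilities of all elements of $R$ are rational numbers, then the winning and losing probabilities (the values of these generating functions at $x=1$) are rational numbers.
   Context: Pile game with boundary for $M\ge2$ players: fix an integer $n\ge1$ and a finite set of integers $R=\{r_1,\dots,r_m\}$ (not necessarily positive), where $r_i$ is assigned probability $p(r_i)\ge0$ with $\sum_i p(r_i)=1$. Player $j$ starts with $s_j$ chips, $0\le s_j<n$. The players take turns cyclically in the order $1,2,\dots,M,1,2,\dots$. At his turn a player chooses, independently of everything else, $r_i\in R$ with probability $p(r_i)$ and replaces his number of chips $c$ by $\max(0,c+r_i)$. The game ends as soon as some player has $n$ chips or more, and that player wins. The winning probability generating function of a player is $\sum_{k\ge0}w(k)x^k$, where $w(k)$ is the probability that this player wins the game at his own $k$-th turn. The losing probability generating function of a player is $\sum_{k\ge0}l(k)x^k$, where $l(k)$ is the probability that the game is won by another player at that other player's $k$-th turn. The winning (losing) probability is $\sum_k w(k)$ (respectively $\sum_k l(k)$). -}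

module Defs where

open import Data.Bool using (if_then_else_)
open import Data.Fin as Fin using (Fin)
import Data.Fin.Properties as Fin
open import Data.Integer as ℤ using (ℤ)
open import Data.List using (List; []; _∷_; map; foldr; filter; upTo; allFin; cartesianProductWith)
open import Data.Maybe using (Maybe; just; nothing)
import Data.Maybe.Properties as Maybe
open import Data.Nat as ℕ using (ℕ; zero; suc; NonZero)
import Data.Nat.DivMod as ℕ
import Data.Nat.Properties as ℕ
open import Data.Product using (_×_; _,_; ∃; proj₁; proj₂)
import Data.Product.Properties as Product
open import Data.Rational as ℚ using (ℚ; 0ℚ; 1ℚ; ½; Positive; ∣_∣)
import Data.Rational.Properties as ℚ
open import Data.Rational.Solver using (module +-*-Solver)
open import Data.Vec as Vec using (Vec; []; _∷_)
open import Data.Vec.Functional using (Vector; updateAt)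
open import Function using (_∘_)
open import Function.Definitions using (Injective)
open import Level using (0ℓ)
open import Relation.Binary.PropositionalEquality using (_≡_; _≢_; refl; sym; cong; subst; module ≡-Reasoning)
open import Relation.Nullary using (does; ¬?; _×-dec_)
open import Relation.Unary using (Pred; Decidable)

Cauchy : (ℕ → ℚ) → Set
Cauchy x = ∀ ε → 0ℚ ℚ.< ε →
  ∃ λ N → ∀ i j → N ℕ.≤ i → N ℕ.≤ j → ∣ x i ℚ.- x j ∣ ℚ.≤ ε

-- Real numbers; the setoid equality is _≈_ below.
record ℝ : Set where
  constructor mkℝ
  field
    seq    : ℕ → ℚ
    cauchy : Cauchy seq

open ℝ public

private
  open +-*-Solver using (solve; _:+_; _:*_; _:-_; _:=_)

  split : ∀ a b c d → (a ℚ.+ b) ℚ.- (c ℚ.+ d) ≡ (a ℚ.- c) ℚ.+ (b ℚ.- d)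
  split = solve 4 (λ a b c d → (a :+ b) :- (c :+ d) := (a :- c) :+ (b :- d)) refl

  splitMul : ∀ a b c d → (a ℚ.* b) ℚ.- (c ℚ.* d) ≡ a ℚ.* (b ℚ.- d) ℚ.+ (a ℚ.- c) ℚ.* d
  splitMul = solve 4 (λ a b c d → (a :* b) :- (c :* d) := a :* (b :- d) :+ (a :- c) :* d) refl

  regroup : ∀ a b → a ≡ (a ℚ.- b) ℚ.+ b
  regroup = solve 2 (λ a b → a := (a :- b) :+ b) refl

  factor : ∀ a b d → a ℚ.* d ℚ.+ d ℚ.* b ≡ (a ℚ.+ b) ℚ.* d
  factor = solve 3 (λ a b d → a :* d :+ d :* b := (a :+ b) :* d) refl

  halves : ∀ ε → ε ℚ.* ½ ℚ.+ ε ℚ.* ½ ≡ ε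
  halves ε = begin
    ε ℚ.* ½ ℚ.+ ε ℚ.* ½ ≡⟨ ℚ.*-distribˡ-+ ε ½ ½ ⟨
    ε ℚ.* 1ℚ            ≡⟨ ℚ.*-identityʳ ε ⟩
    ε                   ∎
    where open ≡-Reasoning

  *-positive : ∀ {a b} → 0ℚ ℚ.< a → 0ℚ ℚ.< b → 0ℚ ℚ.< a ℚ.* b
  *-positive {a} {b} 0<a 0<b =
    ℚ.positive⁻¹ _ {{ℚ.pos*pos⇒pos a {{ℚ.positive 0<a}} b {{ℚ.positive 0<b}}}}

  sum-cauchy : ∀ {x y} → Cauchy x → Cauchy y → Cauchy λ i → x i ℚ.+ y i
  sum-cauchy {x} {y} cx cy ε 0<ε = M ℕ.⊔ N , λ i j M⊔N≤i M⊔N≤j → begin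
    ∣ (x i ℚ.+ y i) ℚ.- (x j ℚ.+ y j) ∣       ≡⟨ cong ∣_∣ (split (x i) (y i) (x j) (y j)) ⟩
    ∣ (x i ℚ.- x j) ℚ.+ (y i ℚ.- y j) ∣       ≤⟨ ℚ.∣p+q∣≤∣p∣+∣q∣ (x i ℚ.- x j) (y i ℚ.- y j) ⟩
    ∣ x i ℚ.- x j ∣ ℚ.+ ∣ y i ℚ.- y j ∣       ≤⟨ ℚ.+-mono-≤
      (proj₂ xM i j (ℕ.m⊔n≤o⇒m≤o M N M⊔N≤i) (ℕ.m⊔n≤o⇒m≤o M N M⊔N≤j))
      (proj₂ yN i j (ℕ.m⊔n≤o⇒n≤o M N M⊔N≤i) (ℕ.m⊔n≤o⇒n≤o M N M⊔N≤j)) ⟩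
    ε ℚ.* ½ ℚ.+ ε ℚ.* ½                       ≡⟨ halves ε ⟩
    ε                                         ∎
    where
    open ℚ.≤-Reasoning
    0<ε/2 = *-positive {ε} {½} 0<ε (ℚ.positive⁻¹ ½)
    xM = cx (ε ℚ.* ½) 0<ε/2
    yN = cy (ε ℚ.* ½) 0<ε/2
    M = proj₁ xM
    N = proj₁ yN

  eventuallyBounded : ∀ {x} → Cauchy x →
    ∃ λ B → 0ℚ ℚ.< B × ∃ λ N → ∀ i → N ℕ.≤ i → ∣ x i ∣ ℚ.≤ B
  eventuallyBounded {x} cx = B , 0<B , N , λ i N≤i → begin
    ∣ x i ∣                            ≡⟨ cong ∣_∣ (regroup (x i) (x N)) ⟩
    ∣ (x i ℚ.- x N) ℚ.+ x N ∣          ≤⟨ ℚ.∣p+q∣≤∣p∣+∣q∣ (x i ℚ.- x N) (x N) ⟩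
    ∣ x i ℚ.- x N ∣ ℚ.+ ∣ x N ∣        ≤⟨ ℚ.+-monoˡ-≤ ∣ x N ∣ (proj₂ xN i N N≤i ℕ.≤-refl) ⟩
    1ℚ ℚ.+ ∣ x N ∣                     ∎
    where
    open ℚ.≤-Reasoning
    xN = cx 1ℚ (ℚ.positive⁻¹ 1ℚ)
    N = proj₁ xN
    B = 1ℚ ℚ.+ ∣ x N ∣
    0<B : 0ℚ ℚ.< B
    0<B = ℚ.+-mono-<-≤ (ℚ.positive⁻¹ 1ℚ) (ℚ.0≤∣p∣ (x N))

  product-cauchy : ∀ {x y} → Cauchy x → Cauchy y → Cauchy λ i → x i ℚ.* y i
  product-cauchy {x} {y} cx cy ε 0<ε = K , λ i j K≤i K≤j → begin
    ∣ x i ℚ.* y i ℚ.- x j ℚ.* y j ∣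
      ≡⟨ cong ∣_∣ (splitMul (x i) (y i) (x j) (y j)) ⟩
    ∣ x i ℚ.* (y i ℚ.- y j) ℚ.+ (x i ℚ.- x j) ℚ.* y j ∣
      ≤⟨ ℚ.∣p+q∣≤∣p∣+∣q∣ (x i ℚ.* (y i ℚ.- y j)) ((x i ℚ.- x j) ℚ.* y j) ⟩
    ∣ x i ℚ.* (y i ℚ.- y j) ∣ ℚ.+ ∣ (x i ℚ.- x j) ℚ.* y j ∣
      ≤⟨ ℚ.+-mono-≤
           (mulBound (x i) (y i ℚ.- y j) 0<A 0<δ (xA i (≤₁ K≤i)) (yδ i j (≤₄ K≤i) (≤₄ K≤j)))
           (mulBound (x i ℚ.- x j) (y j) 0<δ 0<B (xδ i j (≤₃ K≤i) (≤₃ K≤j)) (yB j (≤₂ K≤j))) ⟩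
    A ℚ.* δ ℚ.+ δ ℚ.* B
      ≡⟨ factor A B δ ⟩
    (A ℚ.+ B) ℚ.* δ
      ≡⟨ ℚ.*-assoc (A ℚ.+ B) r ε ⟨
    (A ℚ.+ B) ℚ.* r ℚ.* ε
      ≡⟨ cong (ℚ._* ε) (ℚ.*-inverseʳ (A ℚ.+ B) {{A+B≢0}}) ⟩
    1ℚ ℚ.* ε
      ≡⟨ ℚ.*-identityˡ ε ⟩
    ε ∎
    where
    open ℚ.≤-Reasoning
    bx = eventuallyBounded cx
    by = eventuallyBounded cy
    A = proj₁ bx
    B = proj₁ by
    0<A = proj₁ (proj₂ bx)
    0<B = proj₁ (proj₂ by)
    N₁ = proj₁ (proj₂ (proj₂ bx))
    N₂ = proj₁ (proj₂ (proj₂ by))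
    xA = proj₂ (proj₂ (proj₂ bx))
    yB = proj₂ (proj₂ (proj₂ by))
    A+B>0 : Positive (A ℚ.+ B)
    A+B>0 = ℚ.pos+pos⇒pos A {{ℚ.positive 0<A}} B {{ℚ.positive 0<B}}
    A+B≢0 = ℚ.pos⇒nonZero (A ℚ.+ B) {{A+B>0}}
    r = ℚ.1/_ (A ℚ.+ B) {{A+B≢0}}
    δ = r ℚ.* ε
    0<δ : 0ℚ ℚ.< δ
    0<δ = *-positive {r} {ε} (ℚ.positive⁻¹ r {{ℚ.1/pos⇒pos (A ℚ.+ B) {{A+B>0}}}}) 0<ε
    N₃ = proj₁ (cx δ 0<δ)
    N₄ = proj₁ (cy δ 0<δ)
    xδ = proj₂ (cx δ 0<δ)
    yδ = proj₂ (cy δ 0<δ)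
    K = (N₁ ℕ.⊔ N₂) ℕ.⊔ (N₃ ℕ.⊔ N₄)
    ≤₁ : ∀ {i} → K ℕ.≤ i → N₁ ℕ.≤ i
    ≤₁ = ℕ.m⊔n≤o⇒m≤o N₁ N₂ ∘ ℕ.m⊔n≤o⇒m≤o (N₁ ℕ.⊔ N₂) (N₃ ℕ.⊔ N₄)
    ≤₂ : ∀ {i} → K ℕ.≤ i → N₂ ℕ.≤ i
    ≤₂ = ℕ.m⊔n≤o⇒n≤o N₁ N₂ ∘ ℕ.m⊔n≤o⇒m≤o (N₁ ℕ.⊔ N₂) (N₃ ℕ.⊔ N₄)
    ≤₃ : ∀ {i} → K ℕ.≤ i → N₃ ℕ.≤ i
    ≤₃ = ℕ.m⊔n≤o⇒m≤o N₃ N₄ ∘ ℕ.m⊔n≤o⇒n≤o (N₁ ℕ.⊔ N₂) (N₃ ℕ.⊔ N₄)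
    ≤₄ : ∀ {i} → K ℕ.≤ i → N₄ ℕ.≤ i
    ≤₄ = ℕ.m⊔n≤o⇒n≤o N₃ N₄ ∘ ℕ.m⊔n≤o⇒n≤o (N₁ ℕ.⊔ N₂) (N₃ ℕ.⊔ N₄)
    mulBound : ∀ u v {a b} → 0ℚ ℚ.< a → 0ℚ ℚ.< b →
               ∣ u ∣ ℚ.≤ a → ∣ v ∣ ℚ.≤ b → ∣ u ℚ.* v ∣ ℚ.≤ a ℚ.* b
    mulBound u v {a} {b} 0<a 0<b ∣u∣≤a ∣v∣≤b = begin
      ∣ u ℚ.* v ∣     ≡⟨ ℚ.∣p*q∣≡∣p∣*∣q∣ u v ⟩
      ∣ u ∣ ℚ.* ∣ v ∣ ≤⟨ ℚ.*-monoʳ-≤-nonNeg ∣ v ∣ {{ℚ.nonNegative (ℚ.0≤∣p∣ v)}} ∣u∣≤a ⟩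
      a ℚ.* ∣ v ∣     ≤⟨ ℚ.*-monoˡ-≤-nonNeg a {{ℚ.nonNegative (ℚ.<⇒≤ 0<a)}} ∣v∣≤b ⟩
      a ℚ.* b         ∎

-- Opaque, so that normalising an expression in real sums does not unfold the
-- Cauchy proofs.
abstract
  +-cauchy : ∀ {x y} → Cauchy x → Cauchy y → Cauchy λ i → x i ℚ.+ y i
  +-cauchy {x} {y} = sum-cauchy {x} {y}

  *-cauchy : ∀ {x y} → Cauchy x → Cauchy y → Cauchy λ i → x i ℚ.* y i
  *-cauchy {x} {y} = product-cauchy {x} {y}

fromℚ : ℚ → ℝ
fromℚ q = mkℝ (λ _ → q) λ ε 0<ε → 0 , λ _ _ _ _ →
  subst (ℚ._≤ ε) (sym (cong ∣_∣ (ℚ.+-inverseʳ q))) (ℚ.<⇒≤ 0<ε)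

infix  4 _≈_ _≤_
infixl 6 _+_
infixl 7 _*_

0ℝ 1ℝ : ℝ
0ℝ = fromℚ 0ℚ
1ℝ = fromℚ 1ℚ

_+_ _*_ : ℝ → ℝ → ℝ
x + y = mkℝ (λ i → seq x i ℚ.+ seq y i) (+-cauchy {seq x} {seq y} (cauchy x) (cauchy y))
x * y = mkℝ (λ i → seq x i ℚ.* seq y i) (*-cauchy {seq x} {seq y} (cauchy x) (cauchy y))

_≈_ : ℝ → ℝ → Set
x ≈ y = ∀ ε → 0ℚ ℚ.< ε → ∃ λ N → ∀ i → N ℕ.≤ i → ∣ seq x i ℚ.- seq y i ∣ ℚ.≤ ε

_≤_ : ℝ → ℝ → Set
x ≤ y = ∀ ε → 0ℚ ℚ.< ε → ∃ λ N → ∀ i → N ℕ.≤ i → seq x i ℚ.≤ seq y i ℚ.+ ε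

IsRationalNumber : ℝ → Set
IsRationalNumber x = ∃ λ q → x ≈ fromℚ q

sum product : List ℝ → ℝ
sum     = foldr _+_ 0ℝ
product = foldr _*_ 1ℝ

PowerSeries : Set
PowerSeries = ℕ → ℝ

infixl 7 _⊛_
_⊛_ : PowerSeries → PowerSeries → PowerSeries
(f ⊛ g) k = sum (map (λ i → f i * g (k ℕ.∸ i)) (upTo (suc k)))

-- A polynomial is its list of coefficients, lowest degree first.
polynomial : List ℝ → PowerSeries
polynomial []       _       = 0ℝ
polynomial (a ∷ as) zero    = a
polynomial (a ∷ as) (suc k) = polynomial as k

-- f = P / Q for polynomials P and Q, where Q has a nonzero (that is,
-- invertible) constant term, so that P / Q is defined as a power series.
-- Over ℝ this loses nothing: if f Q = P with Q ≠ 0, a power of x dividing Q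
-- also divides P and can be cancelled.
IsRationalFunction : PowerSeries → Set
IsRationalFunction f = ∃ λ P → ∃ λ Q →
  (∃ λ c → polynomial Q 0 * c ≈ 1ℝ) × (∀ k → (f ⊛ polynomial Q) k ≈ polynomial P k)

infix 4 _SumsTo_
_SumsTo_ : (ℕ → ℝ) → ℝ → Set
f SumsTo L = ∀ ε → 0ℚ ℚ.< ε → ∃ λ N → ∀ K → N ℕ.≤ K →
  let S = sum (map f (upTo K)) in S ≤ L + fromℚ ε × L ≤ S + fromℚ ε

record PileGame : Set where
  field
    players   : ℕ
    players≥2 : 2 ℕ.≤ players
    target    : ℕ
    target≥1  : 1 ℕ.≤ target

    -- R = {r₁, …, r_m}, with probability p i attached to rᵢ
    m           : ℕ
    r           : Fin m → ℤ
    r-injective : Injective _≡_ _≡_ r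
    p           : Fin m → ℝ
    p≥0         : ∀ i → 0ℝ ≤ p i
    Σp≈1        : sum (map p (allFin m)) ≈ 1ℝ

  instance
    players-nonZero : NonZero players
    players-nonZero = ℕ.>-nonZero (ℕ.<-trans ℕ.z<s players≥2)

  Player : Set
  Player = Fin players

  Chips : Set
  Chips = Vector ℕ players

  move : Fin m → ℕ → ℕ
  move i c = ℤ.∣ ℤ.0ℤ ℤ.⊔ (ℤ.+ c ℤ.+ r i) ∣

  -- Turns are numbered globally from 0, so turn t is the (suc (t / players))-th
  -- own turn of player t mod players.  `play t c ω` plays the turns
  -- t, t + 1, … from position c with the successive choices ω; it returns the
  -- winner together with the number of his winning turn, or `nothing` if the
  -- choices run out first.  Only the player to move can newly reach the target.
  play : ∀ {ℓ} → ℕ → Chips → Vec (Fin m) ℓ → Maybe (Player × ℕ)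
  play t c []      = nothing
  play t c (i ∷ ω) =
    let j  = t ℕ.mod players
        c′ = updateAt c j (move i)
    in if does (target ℕ.≤? c′ j)
       then just (j , suc (t ℕ./ players))
       else play (suc t) c′ ω

  sequences : ∀ ℓ → List (Vec (Fin m) ℓ)
  sequences zero    = [] ∷ []
  sequences (suc ℓ) = cartesianProductWith _∷_ (allFin m) (sequences ℓ)

  -- Probability of an event that depends on the first ℓ choices only.
  Pr : ∀ {ℓ} {E : Pred (Vec (Fin m) ℓ) 0ℓ} → Decidable E → ℝ
  Pr {ℓ} E? = sum (map (λ ω → product (map p (Vec.toList ω))) (filter E? (sequences ℓ)))

  module _ (s : Chips) where

    WinsAt : Player → (k : ℕ) → Vec (Fin m) (k ℕ.* players) → Set
    WinsAt j k ω = play 0 s ω ≡ just (j , k)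

    LosesAt : Player → (k : ℕ) → Vec (Fin m) (k ℕ.* players) → Set
    LosesAt j k ω = ∃ λ i → i ≢ j × WinsAt i k ω

    winsAt? : ∀ j k → Decidable (WinsAt j k)
    winsAt? j k ω = Maybe.≡-dec (Product.≡-dec Fin._≟_ ℕ._≟_) (play 0 s ω) (just (j , k))

    losesAt? : ∀ j k → Decidable (LosesAt j k)
    losesAt? j k ω = Fin.any? λ i → ¬? (i Fin.≟ j) ×-dec winsAt? i k ω

    -- The first k * players turns contain exactly the first k own turns of each
    -- player, so they decide whether somebody wins at his own k-th turn.
    winningGF losingGF : Player → PowerSeries
    winningGF j k = Pr (winsAt? j k)
    losingGF  j k = Pr (losesAt? j k)

open PileGame public using (Player; Chips; target; p; winningGF; losingGF)

{-# OPTIONS --safe #-}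
module Submission where

-- Only the M moves of one round matter at a time: from the n^M possible positions
-- at the start of a round there is a matrix A of probabilities that the round ends
-- undecided in a given position, and a vector b of probabilities that it is won by
-- one of the players of interest.  The generating functions f = (f_c) then satisfy
-- f = x b + x A f, and Gaussian elimination over the polynomials makes every f_c
-- rational.  (The losing function is the winning function of the set of all the
-- other players.)
--
-- For rational weights, states of A from which no mass is ever lost have b = 0.
-- On functions supported on the remaining states the Green operator Σ A^k is
-- finite and preserves rationality and nonnegativity: this is proved by removing
-- the states one at a time.  So V = b + A V has a rational solution V ≥ 0, with
-- remainders A^K V = V - Σ_{k<K} A^k b.  These decrease, and they are summable
-- since h = V + A h is solvable as well, hence K A^K V ≤ h and the series
-- converges to V with an explicit modulus.

open import Algebra.Bundles using (CommutativeRing)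
import Algebra.Construct.Pointwise as Pointwise
import Algebra.Properties.Group as GroupProperties
import Algebra.Properties.Monoid.Mult as Mult
import Algebra.Properties.Ring as RingProperties
import Algebra.Properties.Semiring.Sum as Sum
import Algebra.Solver.Ring.NaturalCoefficients.Default as SemiringSolver
open import Data.Bool as Bool using (Bool; true; false; not; if_then_else_; _∧_)
import Data.Bool.Properties as Bool
open import Data.Fin as Fin using (Fin; zero; suc)
import Data.Fin.Properties as Fin
open import Data.Integer as ℤ using ()
import Data.Integer.Properties as ℤ
open import Data.List as List using (List; []; _∷_)
import Data.List.Properties as List
open import Data.Maybe using (Maybe; just; nothing)
import Data.Maybe.Properties as Maybe
open import Data.Nat as ℕ using (ℕ; zero; suc; z≤n; s≤s)
import Data.Nat.DivMod as ℕ
open import Data.Nat.Divisibility using (∣1⇒≡1)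
import Data.Nat.Properties as ℕ
open import Data.Product using (_×_; _,_; ∃; proj₁; proj₂)
import Data.Product.Properties as Product
open import Data.Rational as ℚ using (ℚ; 0ℚ; 1ℚ; ½; ∣_∣)
import Data.Rational.Properties as ℚ
open import Data.Rational.Solver using (module +-*-Solver)
import Data.Rational.Unnormalised as ℚᵘ
import Data.Rational.Unnormalised.Properties as ℚᵘ
open import Data.Sum using ([_,_]′)
open import Data.Vec as Vec using (Vec; []; _∷_)
open import Data.Vec.Functional using (updateAt)
import Data.Vec.Functional.Properties as Vector
open import Defs using (PileGame)
open import Function using (_∘_; id; mk⇔)
open import Level using (0ℓ)
open import Relation.Binary.PropositionalEquality as ≡ using (_≡_; _≢_; _≗_)
import Relation.Binary.Reasoning.Setoid as SetoidReasoning
open import Relation.Nullary using (¬_; Dec; yes; no; does; contradiction; _×-dec_; _→-dec_; decidable-stable)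
open import Relation.Nullary.Decidable using (does-⇔; T?)
open import Relation.Unary using (Pred; Decidable)

-- Power series over a commutative ring

module Series (R : CommutativeRing 0ℓ 0ℓ) where

  open CommutativeRing R hiding (zero)
  open SetoidReasoning setoid
  open SemiringSolver commutativeSemiring using (solve; _:+_; _:*_; _:=_)

  tail : (ℕ → Carrier) → ℕ → Carrier
  tail f = f ∘ suc

  infixl 7 _⋆_
  -- The Cauchy product, recursive in the degree with the left factor shifted, so that the ring laws
  -- follow by induction without index arithmetic. `⊛-⋆` identifies it with the convolution `_⊛_`
  -- over the reals.
  _⋆_ : (ℕ → Carrier) → (ℕ → Carrier) → ℕ → Carrier
  (f ⋆ g) zero    = f 0 * g 0
  (f ⋆ g) (suc k) = f 0 * g (suc k) + (tail f ⋆ g) k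

  ⋆-cong : ∀ {f f′ g g′} → (∀ k → f k ≈ f′ k) → (∀ k → g k ≈ g′ k) → ∀ k → (f ⋆ g) k ≈ (f′ ⋆ g′) k
  ⋆-cong f≈ g≈ zero    = *-cong (f≈ 0) (g≈ 0)
  ⋆-cong f≈ g≈ (suc k) = +-cong (*-cong (f≈ 0) (g≈ (suc k))) (⋆-cong (f≈ ∘ suc) g≈ k)

  ⋆-distribʳ : ∀ f g h k → ((λ i → g i + h i) ⋆ f) k ≈ (g ⋆ f) k + (h ⋆ f) k
  ⋆-distribʳ f g h zero    = distribʳ _ _ _
  ⋆-distribʳ f g h (suc k) = trans (+-congˡ (⋆-distribʳ f (tail g) (tail h) k))
    (solve 5 (λ a b c x y → (a :+ b) :* c :+ (x :+ y) := (a :* c :+ x) :+ (b :* c :+ y))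
       refl (g 0) (h 0) (f (suc k)) ((tail g ⋆ f) k) ((tail h ⋆ f) k))

  ⋆-scaleˡ : ∀ a f g k → ((λ i → a * f i) ⋆ g) k ≈ a * (f ⋆ g) k
  ⋆-scaleˡ a f g zero    = *-assoc _ _ _
  ⋆-scaleˡ a f g (suc k) = trans (+-cong (*-assoc _ _ _) (⋆-scaleˡ a (tail f) g k)) (sym (distribˡ _ _ _))

  -- The mirror image of the defining clause, with the right factor shifted; commutativity needs
  -- both forms.
  ⋆-sucʳ : ∀ f g k → (f ⋆ g) (suc k) ≈ (f ⋆ tail g) k + f (suc k) * g 0
  ⋆-sucʳ f g zero    = refl
  ⋆-sucʳ f g (suc k) = trans (+-congˡ (⋆-sucʳ (tail f) g k)) (sym (+-assoc _ _ _))

  ⋆-comm : ∀ f g k → (f ⋆ g) k ≈ (g ⋆ f) k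
  ⋆-comm f g zero    = *-comm _ _
  ⋆-comm f g (suc k) = begin
    f 0 * g (suc k) + (tail f ⋆ g) k ≈⟨ +-cong (*-comm _ _) (⋆-comm (tail f) g k) ⟩
    g (suc k) * f 0 + (g ⋆ tail f) k ≈⟨ +-comm _ _ ⟩
    (g ⋆ tail f) k + g (suc k) * f 0 ≈⟨ ⋆-sucʳ g f k ⟨
    (g ⋆ f) (suc k)                  ∎

  ⋆-assoc : ∀ f g h k → ((f ⋆ g) ⋆ h) k ≈ (f ⋆ (g ⋆ h)) k
  ⋆-assoc f g h zero    = *-assoc _ _ _
  ⋆-assoc f g h (suc k) = begin
    f 0 * g 0 * h (suc k) + (tail (f ⋆ g) ⋆ h) k
      ≈⟨ +-congˡ (⋆-distribʳ h (λ i → f 0 * tail g i) (tail f ⋆ g) k) ⟩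
    f 0 * g 0 * h (suc k) + (((λ i → f 0 * tail g i) ⋆ h) k + ((tail f ⋆ g) ⋆ h) k)
      ≈⟨ +-congˡ (+-cong (⋆-scaleˡ (f 0) (tail g) h k) (⋆-assoc (tail f) g h k)) ⟩
    f 0 * g 0 * h (suc k) + (f 0 * (tail g ⋆ h) k + (tail f ⋆ (g ⋆ h)) k)
      ≈⟨ solve 5 (λ a b c x y → a :* b :* c :+ (a :* x :+ y) := a :* (b :* c :+ x) :+ y)
           refl (f 0) (g 0) (h (suc k)) ((tail g ⋆ h) k) ((tail f ⋆ (g ⋆ h)) k) ⟩
    f 0 * (g 0 * h (suc k) + (tail g ⋆ h) k) + (tail f ⋆ (g ⋆ h)) k ∎

  VanishesFrom : ℕ → (ℕ → Carrier) → Set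
  VanishesFrom N f = ∀ k → N ℕ.≤ k → f k ≈ 0#

  ⋆-zeroˡ : ∀ f g → VanishesFrom 0 f → VanishesFrom 0 (f ⋆ g)
  ⋆-zeroˡ f g f≈0 zero    _ = trans (*-congʳ (f≈0 0 z≤n)) (zeroˡ _)
  ⋆-zeroˡ f g f≈0 (suc k) _ = trans
    (+-cong (trans (*-congʳ (f≈0 0 z≤n)) (zeroˡ _)) (⋆-zeroˡ (tail f) g (λ i _ → f≈0 (suc i) z≤n) k z≤n))
    (+-identityʳ _)

  -- Each shift of `f` lowers `N` by one, and the term split off vanishes because `g` does in that
  -- degree. The bound `N + M` is not sharp but needs no predecessor.
  vanishes-⋆ : ∀ N M f g → VanishesFrom N f → VanishesFrom M g → VanishesFrom (N ℕ.+ M) (f ⋆ g)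
  vanishes-⋆ zero    M f g f≈0 g≈0 k       _             = ⋆-zeroˡ f g f≈0 k z≤n
  vanishes-⋆ (suc N) M f g f≈0 g≈0 (suc k) (s≤s N+M≤k) = trans
    (+-cong (trans (*-congˡ (g≈0 (suc k) (ℕ.≤-trans (ℕ.m≤n+m M N) (ℕ.m≤n⇒m≤1+n N+M≤k)))) (zeroʳ _))
            (vanishes-⋆ N M (tail f) g (λ i N≤i → f≈0 (suc i) (s≤s N≤i)) g≈0 k N+M≤k))
    (+-identityʳ _)

  constant : Carrier → ℕ → Carrier
  constant a zero    = a
  constant a (suc k) = 0#

  constant-⋆ : ∀ a f k → (constant a ⋆ f) k ≈ a * f k
  constant-⋆ a f zero    = refl
  constant-⋆ a f (suc k) = trans (+-congˡ (⋆-zeroˡ _ f (λ _ _ → refl) k z≤n)) (+-identityʳ _)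

  one : ℕ → Carrier
  one = constant 1#

  ⋆-identityˡ : ∀ f k → (one ⋆ f) k ≈ f k
  ⋆-identityˡ f k = trans (constant-⋆ 1# f k) (*-identityˡ _)

  seriesRing : CommutativeRing 0ℓ 0ℓ
  seriesRing = record
    { Carrier = ℕ → Carrier
    ; _≈_     = λ f g → ∀ k → f k ≈ g k
    ; _+_     = λ f g k → f k + g k
    ; _*_     = _⋆_
    ; -_      = λ f k → - f k
    ; 0#      = λ _ → 0#
    ; 1#      = one
    ; isCommutativeRing = record
      { isRing = record
        { +-isAbelianGroup = Pointwise.isAbelianGroup ℕ +-isAbelianGroup
        ; *-cong = ⋆-cong
        ; *-assoc = ⋆-assoc
        ; *-identity = ⋆-identityˡ , λ f k → trans (⋆-comm f one k) (⋆-identityˡ f k)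
        ; distrib = (λ f g h k → trans (⋆-comm f _ k) (trans (⋆-distribʳ f g h k)
                      (+-cong (⋆-comm g f k) (⋆-comm h f k)))) , ⋆-distribʳ
        }
      ; *-comm = ⋆-comm
      }
    }

  private module S = CommutativeRing seriesRing
  private module Σˢ = Sum S.semiring
  open SemiringSolver S.commutativeSemiring using () renaming (solve to solveˢ; _:+_ to _⊹_; _:*_ to _⊠_; _:=_ to _≐_)

  -- Rational power series and linear systems with polynomial coefficients

  IsPolynomial : S.Carrier → Set
  IsPolynomial f = ∃ λ N → VanishesFrom N f

  polynomial-+ : ∀ {f g} → IsPolynomial f → IsPolynomial g → IsPolynomial (f S.+ g)
  polynomial-+ (N , f≈0) (M , g≈0) = N ℕ.⊔ M , λ k N⊔M≤k → trans
    (+-cong (f≈0 k (ℕ.m⊔n≤o⇒m≤o N M N⊔M≤k)) (g≈0 k (ℕ.m⊔n≤o⇒n≤o N M N⊔M≤k))) (+-identityʳ _)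

  polynomial-* : ∀ {f g} → IsPolynomial f → IsPolynomial g → IsPolynomial (f ⋆ g)
  polynomial-* {f} {g} (N , f≈0) (M , g≈0) = N ℕ.+ M , vanishes-⋆ N M f g f≈0 g≈0

  polynomial-neg : ∀ {f} → IsPolynomial f → IsPolynomial (S.- f)
  polynomial-neg (N , f≈0) = N , λ k N≤k → trans (-‿cong (f≈0 k N≤k)) (RingProperties.-0#≈0# ring)

  -- Normalising the constant term of the denominator to 1 makes denominators closed under products
  -- and invertible as series, with no division in `R`.
  record Rational (f : S.Carrier) : Set where
    constructor fraction
    field
      {numerator denominator} : S.Carrier
      numerator-polynomial    : IsPolynomial numerator
      denominator-polynomial  : IsPolynomial denominator
      denominator-at-0        : denominator 0 ≈ 1#
      equation                : f ⋆ denominator S.≈ numerator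

  unit-* : ∀ {a b} → a ≈ 1# → b ≈ 1# → a * b ≈ 1#
  unit-* a≈1 b≈1 = trans (*-cong a≈1 b≈1) (*-identityˡ 1#)

  rational-cong : ∀ {f g} → f S.≈ g → Rational f → Rational g
  rational-cong {f} {g} f≈g (fraction {_} {q} P Q q₀ e) =
    fraction P Q q₀ (S.trans (⋆-cong {g} {f} {q} (S.sym {f} {g} f≈g) (S.refl {q})) e)

  rational-polynomial : ∀ {f} → IsPolynomial f → Rational f
  rational-polynomial {f} F = fraction F (1 , λ { (suc k) _ → refl }) refl (S.*-identityʳ f)

  rational-+ : ∀ {f g} → Rational f → Rational g → Rational (f S.+ g)
  rational-+ {f} {g} (fraction {p} {q} P Q q₀ e) (fraction {p′} {q′} P′ Q′ q₀′ e′) =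
    fraction (polynomial-+ (polynomial-* P Q′) (polynomial-* P′ Q)) (polynomial-* Q Q′)
      (unit-* q₀ q₀′)
      (S.trans (solveˢ 4 (λ f g q q′ → (f ⊹ g) ⊠ (q ⊠ q′) ≐ (f ⊠ q) ⊠ q′ ⊹ (g ⊠ q′) ⊠ q) (λ _ → refl) f g q q′)
               (S.+-cong (S.*-congʳ e) (S.*-congʳ e′)))

  rational-* : ∀ {a f} → IsPolynomial a → Rational f → Rational (a ⋆ f)
  rational-* {a} {f} A (fraction {p} {q} P Q q₀ e) =
    fraction (polynomial-* A P) Q q₀ (S.trans (S.*-assoc a f q) (S.*-congˡ {a} e))

  rational-sum : ∀ n {f : Fin n → S.Carrier} → (∀ i → Rational (f i)) → Rational (Σˢ.sum f)
  rational-sum zero    r = rational-polynomial (0 , λ _ _ → refl)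
  rational-sum (suc n) r = rational-+ (r zero) (rational-sum n (r ∘ suc))

  -- The factor `u` is absorbed into the denominator.
  rational-divide : ∀ {u f} → IsPolynomial u → u 0 ≈ 1# → Rational (u ⋆ f) → Rational f
  rational-divide {u} {f} U u₀ (fraction {p} {q} P Q q₀ e) =
    fraction P (polynomial-* U Q) (unit-* u₀ q₀)
      (S.trans (solveˢ 3 (λ u f q → f ⊠ (u ⊠ q) ≐ (u ⊠ f) ⊠ q) (λ _ → refl) u f q) e)

  -- Fraction-free Gaussian elimination: all coefficients stay polynomials, and
  -- the common factor u on the left keeps constant term 1.
  system-rational : ∀ n (u : S.Carrier) (a : Fin n → Fin n → S.Carrier) (b v : Fin n → S.Carrier) →
    IsPolynomial u → u 0 ≈ 1# →
    (∀ c d → IsPolynomial (a c d)) → (∀ c d → a c d 0 ≈ 0#) → (∀ c → IsPolynomial (b c)) →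
    (∀ c → u ⋆ v c S.≈ b c S.+ Σˢ.sum (λ d → a c d ⋆ v d)) → ∀ c → Rational (v c)
  system-rational (suc n) u a b v U u₀ A a₀ B e = result
    where
    a₀₀ = a zero zero
    v₀  = v zero
    b₀  = b zero
    -- The coefficient of `v₀` once the diagonal term is moved to the left; its constant term is
    -- still 1 because that of `a₀₀` is 0.
    w   = u S.- a₀₀
    s : Fin (suc n) → S.Carrier
    s c = Σˢ.sum (λ d → a c (suc d) ⋆ v (suc d))

    W : IsPolynomial w
    W = polynomial-+ U (polynomial-neg (A zero zero))

    w₀ : w 0 ≈ 1#
    w₀ = trans (+-cong u₀ (trans (-‿cong (a₀ zero zero)) (RingProperties.-0#≈0# ring))) (+-identityʳ 1#)

    w+a : w S.+ a₀₀ S.≈ u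
    w+a k = trans (+-assoc _ _ _) (trans (+-congˡ (-‿inverseˡ _)) (+-identityʳ _))

    pivot : w ⋆ v₀ S.≈ b₀ S.+ s zero
    -- The solver proves semiring identities only, so instead of subtracting `a₀₀ ⋆ v₀` it is added
    -- on both sides and cancelled.
    pivot = GroupProperties.∙-cancelʳ S.+-group (a₀₀ ⋆ v₀) (w ⋆ v₀) (b₀ S.+ s zero)
      (S.trans (S.sym (S.distribʳ v₀ w a₀₀))
      (S.trans (S.*-congʳ {v₀} w+a)
      (S.trans (e zero)
        (solveˢ 3 (λ b x y → b ⊹ (x ⊹ y) ≐ (b ⊹ y) ⊹ x) (λ _ → refl) b₀ (a₀₀ ⋆ v₀) (s zero)))))

    -- Row `suc c` is multiplied by `w`, and then `w ⋆ v₀` is replaced by its value from `pivot`;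
    -- this gives the new coefficients `a′`, `b′` and the new left factor `u ⋆ w`.
    a′ : Fin n → Fin n → S.Carrier
    a′ c d = a (suc c) zero ⋆ a zero (suc d) S.+ w ⋆ a (suc c) (suc d)

    b′ : Fin n → S.Carrier
    b′ c = w ⋆ b (suc c) S.+ a (suc c) zero ⋆ b₀

    sum′ : ∀ c → Σˢ.sum (λ d → a′ c d ⋆ v (suc d)) S.≈ a (suc c) zero ⋆ s zero S.+ w ⋆ s (suc c)
    sum′ c = S.trans
      (Σˢ.sum-cong-≋ {n} (λ d → solveˢ 5 (λ x y w z v → (x ⊠ y ⊹ w ⊠ z) ⊠ v ≐ x ⊠ (y ⊠ v) ⊹ w ⊠ (z ⊠ v)) (λ _ → refl)
        (a (suc c) zero) (a zero (suc d)) w (a (suc c) (suc d)) (v (suc d))))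
      (S.trans (Σˢ.∑-distrib-+ {n} (λ d → a (suc c) zero ⋆ (a zero (suc d) ⋆ v (suc d))) (λ d → w ⋆ (a (suc c) (suc d) ⋆ v (suc d))))
        (S.sym (S.+-cong (Σˢ.*-distribˡ-sum (a (suc c) zero) (λ d → a zero (suc d) ⋆ v (suc d)))
                         (Σˢ.*-distribˡ-sum w (λ d → a (suc c) (suc d) ⋆ v (suc d))))))

    e′ : ∀ c → (u ⋆ w) ⋆ v (suc c) S.≈ b′ c S.+ Σˢ.sum (λ d → a′ c d ⋆ v (suc d))
    e′ c =
      S.trans (solveˢ 3 (λ u w v → (u ⊠ w) ⊠ v ≐ w ⊠ (u ⊠ v)) (λ _ → refl) u w (v (suc c)))
      (S.trans (S.*-congˡ {w} (e (suc c)))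
      (S.trans (solveˢ 5 (λ w b a v s → w ⊠ (b ⊹ (a ⊠ v ⊹ s)) ≐ w ⊠ b ⊹ (a ⊠ (w ⊠ v) ⊹ w ⊠ s)) (λ _ → refl)
                 w (b (suc c)) (a (suc c) zero) v₀ (s (suc c)))
      (S.trans (S.+-congˡ {w ⋆ b (suc c)} (S.+-congʳ {w ⋆ s (suc c)} (S.*-congˡ {a (suc c) zero} pivot)))
      (S.trans (solveˢ 5 (λ x a b s t → x ⊹ (a ⊠ (b ⊹ s) ⊹ t) ≐ (x ⊹ a ⊠ b) ⊹ (a ⊠ s ⊹ t)) (λ _ → refl)
                 (w ⋆ b (suc c)) (a (suc c) zero) b₀ (s zero) (w ⋆ s (suc c)))
        (S.+-congˡ {b′ c} (S.sym (sum′ c)))))))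

    others : ∀ c → Rational (v (suc c))
    others = system-rational n (u ⋆ w) a′ b′ (v ∘ suc)
      (polynomial-* U W) (unit-* u₀ w₀)
      (λ c d → polynomial-+ (polynomial-* (A (suc c) zero) (A zero (suc d))) (polynomial-* W (A (suc c) (suc d))))
      (λ c d → trans (+-cong (trans (*-congˡ (a₀ zero (suc d))) (zeroʳ _)) (trans (*-congˡ (a₀ (suc c) (suc d))) (zeroʳ _))) (+-identityʳ _))
      (λ c → polynomial-+ (polynomial-* W (B (suc c))) (polynomial-* (A (suc c) zero) (B zero)))
      e′

    result : ∀ c → Rational (v c)
    -- Back substitution: `pivot` expresses `w ⋆ v₀` through the other unknowns, and `w` is divided
    -- out.
    result zero    = rational-divide W w₀ (rational-cong (S.sym {w ⋆ v₀} {b₀ S.+ s zero} pivot)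
      (rational-+ (rational-polynomial (B zero))
        (rational-sum n (λ d → rational-* (A zero (suc d)) (others d)))))
    result (suc c) = others c

  -- The series a x, of degree one: multiplication by it is a delay by one round.
  monomial : Carrier → ℕ → Carrier
  monomial a zero    = 0#
  monomial a (suc k) = constant a k

  monomial-polynomial : ∀ a → IsPolynomial (monomial a)
  monomial-polynomial a = 2 , λ { (suc zero) (s≤s ()) ; (suc (suc k)) _ → refl }

  monomial-⋆ : ∀ a f k → (monomial a ⋆ f) (suc k) ≈ a * f k
  monomial-⋆ a f k = trans (+-cong (zeroˡ _) (constant-⋆ a f k)) (+-identityˡ _)

  private module Σᴿ = Sum semiring

  sum-at : ∀ n (f : Fin n → S.Carrier) k → Σˢ.sum f k ≈ Σᴿ.sum (λ d → f d k)
  sum-at zero    f k = refl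
  sum-at (suc n) f k = +-congˡ (sum-at n (f ∘ suc) k)

  -- The coefficientwise form of f = x b + x A f.
  recurrence-rational : ∀ n (A : Fin n → Fin n → Carrier) (b : Fin n → Carrier) (f : Fin n → S.Carrier) →
    (∀ c → f c 0 ≈ 0#) →
    (∀ c k → f c (suc k) ≈ constant (b c) k + Σᴿ.sum (λ d → A c d * f d k)) →
    ∀ c → Rational (f c)
  recurrence-rational n A b f f₀ f₊ = system-rational n one (λ c d → monomial (A c d)) (monomial ∘ b) f
    (1 , λ { (suc k) _ → refl }) refl (λ c d → monomial-polynomial (A c d)) (λ _ _ → refl)
    (monomial-polynomial ∘ b)
    (λ c k → trans (⋆-identityˡ (f c) k) (trans (eq c k)
      (+-congˡ (sym (sum-at n (λ d → monomial (A c d) ⋆ f d) k)))))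
    where
    eq : ∀ c k → f c k ≈ monomial (b c) k + Σᴿ.sum (λ d → (monomial (A c d) ⋆ f d) k)
    eq c zero    = trans (f₀ c) (trans (sym (Σᴿ.sum-replicate-zero n))
      (trans (Σᴿ.sum-cong-≋ {n} (λ d → sym (zeroˡ _))) (sym (+-identityˡ _))))
    eq c (suc k) = trans (f₊ c k) (+-congˡ (Σᴿ.sum-cong-≋ {n} (λ d → sym (monomial-⋆ (A c d) (f d) k))))

-- Substochastic rational matrices

module Substochastic where

  open ≡ using (refl; sym; trans; cong; cong₂; subst; subst₂; module ≡-Reasoning)
  open import Data.Rational using (_+_; _*_; _-_; _≤_; _<_)
  module Σℚ = Sum (CommutativeRing.semiring ℚ.+-*-commutativeRing)
  open Σℚ using (sum)
  open Mult ℚ.+-0-monoid using () renaming (_×_ to _·_)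
  open +-*-Solver using (solve; _:+_; _:*_; _:-_; :-_; _:=_; con)

  0≤+ : ∀ {a b} → 0ℚ ≤ a → 0ℚ ≤ b → 0ℚ ≤ a + b
  0≤+ 0≤a 0≤b = ℚ.+-mono-≤ 0≤a 0≤b

  0≤* : ∀ {a b} → 0ℚ ≤ a → 0ℚ ≤ b → 0ℚ ≤ a * b
  0≤* {a} {b} 0≤a 0≤b =
    ℚ.nonNegative⁻¹ _ {{ℚ.nonNeg*nonNeg⇒nonNeg a {{ℚ.nonNegative 0≤a}} b {{ℚ.nonNegative 0≤b}}}}

  ≤+ʳ : ∀ a {b} → 0ℚ ≤ b → a ≤ a + b
  ≤+ʳ a {b} 0≤b = subst (_≤ a + b) (ℚ.+-identityʳ a) (ℚ.+-monoʳ-≤ a 0≤b)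

  ≤+ˡ : ∀ {a} b → 0ℚ ≤ a → b ≤ a + b
  ≤+ˡ {a} b 0≤a = subst (_≤ a + b) (ℚ.+-identityˡ b) (ℚ.+-monoˡ-≤ b 0≤a)

  +≡0⇒≡0ˡ : ∀ {a b} → 0ℚ ≤ a → 0ℚ ≤ b → a + b ≡ 0ℚ → a ≡ 0ℚ
  +≡0⇒≡0ˡ {a} 0≤a 0≤b e = ℚ.≤-antisym (subst (a ≤_) e (≤+ʳ a 0≤b)) 0≤a

  +≡0⇒≡0ʳ : ∀ {a b} → 0ℚ ≤ a → 0ℚ ≤ b → a + b ≡ 0ℚ → b ≡ 0ℚ
  +≡0⇒≡0ʳ {b = b} 0≤a 0≤b e = ℚ.≤-antisym (subst (b ≤_) e (≤+ˡ b 0≤a)) 0≤b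

  *≡0⇒≡0 : ∀ {a b} → a ≢ 0ℚ → a * b ≡ 0ℚ → b ≡ 0ℚ
  *≡0⇒≡0 {a} {b} a≢0 ab≡0 = begin
    b               ≡⟨ ℚ.*-identityˡ b ⟨
    1ℚ * b          ≡⟨ cong (_* b) (ℚ.*-inverseˡ a) ⟨
    ℚ.1/ a * a * b  ≡⟨ ℚ.*-assoc (ℚ.1/ a) a b ⟩
    ℚ.1/ a * (a * b) ≡⟨ cong (ℚ.1/ a *_) ab≡0 ⟩
    ℚ.1/ a * 0ℚ     ≡⟨ ℚ.*-zeroʳ (ℚ.1/ a) ⟩
    0ℚ              ∎
    where
    open ≡-Reasoning
    instance _ = ℚ.≢-nonZero a≢0

  a≡b+[a-b] : ∀ a b → a ≡ b + (a - b)
  a≡b+[a-b] = solve 2 (λ a b → a := b :+ (a :- b)) refl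

  +-cancelˡ-≤ : ∀ a {b c} → a + b ≤ a + c → b ≤ c
  +-cancelˡ-≤ a {b} {c} ab≤ac = subst₂ _≤_ (shift a b) (shift a c) (ℚ.+-monoʳ-≤ (ℚ.- a) ab≤ac)
    where
    shift : ∀ a b → ℚ.- a + (a + b) ≡ b
    shift = solve 2 (λ a b → :- a :+ (a :+ b) := b) refl

  ≤⇒0≤- : ∀ {a b} → a ≤ b → 0ℚ ≤ b - a
  ≤⇒0≤- {a} {b} a≤b = subst (_≤ b - a) (ℚ.+-inverseʳ a) (ℚ.+-monoˡ-≤ (ℚ.- a) a≤b)

  -≡0⇒≡ : ∀ {a b} → a - b ≡ 0ℚ → a ≡ b
  -≡0⇒≡ {a} {b} e = trans (a≡b+[a-b] a b) (trans (cong (b +_) e) (ℚ.+-identityʳ b))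

  reciprocal : ∀ {a} → 0ℚ ≤ a → a ≢ 0ℚ → ∃ λ q → 0ℚ ≤ q × q ≢ 0ℚ × q * a ≡ 1ℚ
  reciprocal {a} 0≤a a≢0 = ℚ.1/ a , ℚ.<⇒≤ 0<q , (λ e → ℚ.<⇒≢ 0<q (sym e)) , ℚ.*-inverseˡ a
    where
    instance
      a>0 = ℚ.nonNeg∧nonZero⇒pos a {{ℚ.nonNegative 0≤a}} {{ℚ.≢-nonZero a≢0}}
      _ = ℚ.pos⇒nonZero a
    0<q = ℚ.positive⁻¹ _ {{ℚ.1/pos⇒pos a}}

  sum-nonNegative : ∀ n {f : Fin n → ℚ} → (∀ i → 0ℚ ≤ f i) → 0ℚ ≤ sum f
  sum-nonNegative zero    0≤f = ℚ.≤-refl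
  sum-nonNegative (suc n) 0≤f = 0≤+ (0≤f zero) (sum-nonNegative n (0≤f ∘ suc))

  sum-mono : ∀ n {f g : Fin n → ℚ} → (∀ i → f i ≤ g i) → sum f ≤ sum g
  sum-mono zero    f≤g = ℚ.≤-refl
  sum-mono (suc n) f≤g = ℚ.+-mono-≤ (f≤g zero) (sum-mono n (f≤g ∘ suc))

  sum≡0⇒≡0 : ∀ n {f : Fin n → ℚ} → (∀ i → 0ℚ ≤ f i) → sum f ≡ 0ℚ → ∀ i → f i ≡ 0ℚ
  sum≡0⇒≡0 (suc n) 0≤f e zero    = +≡0⇒≡0ˡ (0≤f zero) (sum-nonNegative n (0≤f ∘ suc)) e
  sum≡0⇒≡0 (suc n) 0≤f e (suc i) = sum≡0⇒≡0 n (0≤f ∘ suc) (+≡0⇒≡0ʳ (0≤f zero) (sum-nonNegative n (0≤f ∘ suc)) e) i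

  sum-zero : ∀ n {f : Fin n → ℚ} → (∀ i → f i ≡ 0ℚ) → sum f ≡ 0ℚ
  sum-zero n f≡0 = trans (Σℚ.sum-cong-≋ {n} f≡0) (Σℚ.sum-replicate-zero n)

  does-true : ∀ {P : Set} (P? : Dec P) → not (does P?) ≡ false → P
  does-true (yes p) _ = p

  does-false : ∀ {P : Set} (P? : Dec P) → not (does P?) ≡ true → ¬ P
  does-false (no ¬p) _ = ¬p

  -- Transient and recurrent states, by removing one state at a time

  IsSubstochastic : ∀ {n} → (Fin n → Fin n → ℚ) → Set
  IsSubstochastic A = (∀ c d → 0ℚ ≤ A c d) × (∀ c → sum (A c) ≤ 1ℚ)

  SupportedOn : ∀ {n} → (Fin n → Bool) → (Fin n → ℚ) → Set
  SupportedOn T u = ∀ c → T c ≡ false → u c ≡ 0ℚ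

  -- The transient states are those from which mass is eventually lost; on
  -- functions supported there, the Green operator u ↦ Σ A^k u is finite.
  record Transience {n} (A : Fin n → Fin n → ℚ) : Set where
    field
      transient : Fin n → Bool
      recurrent-row    : ∀ c → transient c ≡ false → sum (A c) ≡ 1ℚ
      recurrent-closed : ∀ c d → transient c ≡ false → transient d ≡ true → A c d ≡ 0ℚ
      potential : ∀ u → (∀ c → 0ℚ ≤ u c) → SupportedOn transient u →
        ∃ λ V → (∀ c → 0ℚ ≤ V c) × SupportedOn transient V × (∀ c → V c ≡ u c + sum (λ d → A c d * V d))

  -- State 0 never leaves itself, so it is recurrent. A potential is 0 there, hence the equations of
  -- the other states involve only the submatrix `A′`.
  module AbsorbingState {n} (A : Fin (suc n) → Fin (suc n) → ℚ) (sub : IsSubstochastic A)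
                        (a₀₀≡1 : A zero zero ≡ 1ℚ) where

    A′ : Fin n → Fin n → ℚ
    A′ c d = A (suc c) (suc d)

    -- The diagonal entry already exhausts the row sum, which is at most 1.
    a₀≡0 : ∀ d → A zero (suc d) ≡ 0ℚ
    a₀≡0 = sum≡0⇒≡0 n (λ d → proj₁ sub zero (suc d)) (ℚ.≤-antisym
      (+-cancelˡ-≤ (A zero zero) (subst (A zero zero + sum (λ d → A zero (suc d)) ≤_) (sym (trans (ℚ.+-identityʳ (A zero zero)) a₀₀≡1)) (proj₂ sub zero)))
      (sum-nonNegative n (λ d → proj₁ sub zero (suc d))))

    substochastic : IsSubstochastic A′
    substochastic = (λ c d → proj₁ sub (suc c) (suc d)) ,
      (λ c → ℚ.≤-trans (≤+ˡ _ (proj₁ sub (suc c) zero)) (proj₂ sub (suc c)))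

    module _ (t : Transience A′) where

      open Transience t

      T : Fin (suc n) → Bool
      T zero    = false
      T (suc c) = transient c

      extend : Transience A
      extend = record
        { transient = T
        ; recurrent-row = λ
          { zero    _  → trans (cong₂ _+_ a₀₀≡1 (sum-zero n a₀≡0)) (ℚ.+-identityʳ 1ℚ)
          ; (suc c) tc → ℚ.≤-antisym (proj₂ sub (suc c))
              (subst (_≤ sum (A (suc c))) (recurrent-row c tc) (≤+ˡ (sum (A′ c)) (proj₁ sub (suc c) zero)))
          }
        ; recurrent-closed = λ
          { zero    (suc d) _  _  → a₀≡0 d
          ; (suc c) (suc d) tc td → recurrent-closed c d tc td
          }
        ; potential = λ u 0≤u su →
            let V , 0≤V , sV , eV = potential (u ∘ suc) (0≤u ∘ suc) (su ∘ suc)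
            in (λ { zero → 0ℚ ; (suc c) → V c })
             , (λ { zero → ℚ.≤-refl ; (suc c) → 0≤V c })
             , (λ { zero _ → refl ; (suc c) → sV c })
             , (λ { zero → sym (trans (cong₂ _+_ (su zero refl)
                      (trans (cong₂ _+_ (ℚ.*-zeroʳ (A zero zero)) (sum-zero n (λ d → trans (cong (_* V d) (a₀≡0 d)) (ℚ.*-zeroˡ (V d))))) (ℚ.+-identityʳ 0ℚ))) (ℚ.+-identityʳ 0ℚ))
                  ; (suc c) → trans (eV c) (cong (u (suc c) +_) (sym (trans (cong (_+ sum (λ d → A′ c d * V d)) (ℚ.*-zeroʳ (A (suc c) zero))) (ℚ.+-identityˡ (sum (λ d → A′ c d * V d)))))) })
        }

  -- Censoring: A′ is the chain watched outside state 0.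
  module Censoring {n} (A : Fin (suc n) → Fin (suc n) → ℚ) (sub : IsSubstochastic A)
                   (a₀₀≢1 : A zero zero ≢ 1ℚ) where

    0≤A : ∀ c d → 0ℚ ≤ A c d
    0≤A = proj₁ sub

    a₀₀ = A zero zero

    s₀ : ℚ
    s₀ = sum (λ d → A zero (suc d))

    0≤s₀ : 0ℚ ≤ s₀
    0≤s₀ = sum-nonNegative n (0≤A zero ∘ suc)

    a₀₀≤1 : a₀₀ ≤ 1ℚ
    a₀₀≤1 = ℚ.≤-trans (≤+ʳ a₀₀ 0≤s₀) (proj₂ sub zero)

    -- `q` is the geometric series 1/(1 - a₀₀), the expected length of a stay in state 0.
    recip = reciprocal {1ℚ - a₀₀} (≤⇒0≤- a₀₀≤1) (λ e → a₀₀≢1 (sym (-≡0⇒≡ e)))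
    q = proj₁ recip
    0≤q = proj₁ (proj₂ recip)
    q≢0 = proj₁ (proj₂ (proj₂ recip))
    q-inverse : q * (1ℚ - a₀₀) ≡ 1ℚ
    q-inverse = proj₂ (proj₂ (proj₂ recip))

    A′ : Fin n → Fin n → ℚ
    A′ c d = A (suc c) (suc d) + A (suc c) zero * q * A zero (suc d)

    0≤aq : ∀ c → 0ℚ ≤ A (suc c) zero * q
    0≤aq c = 0≤* (0≤A (suc c) zero) 0≤q

    loss : ℚ
    loss = 1ℚ - (a₀₀ + s₀)

    0≤loss : 0ℚ ≤ loss
    0≤loss = ≤⇒0≤- (proj₂ sub zero)

    -- Mass is conserved by censoring except on paths that enter state 0 and get lost from there;
    -- after any number of loops this has weight `A (suc c) zero * q * loss`.
    row-sum : ∀ c → sum (A′ c) + A (suc c) zero * q * loss ≡ sum (A (suc c))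
    row-sum c = begin
      sum (A′ c) + a * q * loss
        ≡⟨ cong (_+ a * q * loss) (Σℚ.∑-distrib-+ {n} (λ d → A (suc c) (suc d)) (λ d → a * q * A zero (suc d))) ⟩
      r + sum (λ d → a * q * A zero (suc d)) + a * q * loss
        ≡⟨ cong (λ z → r + z + a * q * loss) (Σℚ.*-distribˡ-sum {n} (a * q) (λ d → A zero (suc d))) ⟨
      r + a * q * s₀ + a * q * (1ℚ - (a₀₀ + s₀))
        ≡⟨ solve 6 (λ r a q s o z → r :+ a :* q :* s :+ a :* q :* (o :- (z :+ s)) := a :* (q :* (o :- z)) :+ r) refl r a q s₀ 1ℚ a₀₀ ⟩
      a * (q * (1ℚ - a₀₀)) + r
        ≡⟨ cong (λ z → a * z + r) q-inverse ⟩
      a * 1ℚ + r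
        ≡⟨ cong (_+ r) (ℚ.*-identityʳ a) ⟩
      a + r ∎
      where
      open ≡-Reasoning
      a = A (suc c) zero
      r = sum (λ d → A (suc c) (suc d))

    substochastic : IsSubstochastic A′
    substochastic = (λ c d → 0≤+ (0≤A _ _) (0≤* (0≤aq c) (0≤A _ _))) , λ c → ℚ.≤-trans
      (subst (sum (A′ c) ≤_) (row-sum c) (≤+ʳ _ (0≤* (0≤aq c) 0≤loss))) (proj₂ sub (suc c))

    module _ (t : Transience A′) where

      open Transience t

      -- State 0 counts as recurrent when it loses no mass and sends none to states already known to
      -- be transient.
      Recurrent₀ : Set
      Recurrent₀ = (a₀₀ + s₀ ≡ 1ℚ) × (∀ d → transient d ≡ true → A zero (suc d) ≡ 0ℚ)

      recurrent₀? : Dec Recurrent₀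
      recurrent₀? = ((a₀₀ + s₀) ℚ.≟ 1ℚ) ×-dec
        Fin.all? (λ d → (transient d Bool.≟ true) →-dec (A zero (suc d) ℚ.≟ 0ℚ))

      row′≡1 : ∀ c → transient c ≡ false → sum (A (suc c)) ≡ 1ℚ
      row′≡1 c tc = ℚ.≤-antisym (proj₂ sub (suc c))
        (subst (_≤ sum (A (suc c))) (recurrent-row c tc)
          (subst (sum (A′ c) ≤_) (row-sum c) (≤+ʳ _ (0≤* (0≤aq c) 0≤loss))))

      aq≢0 : ∀ {a} → a ≢ 0ℚ → a * q ≢ 0ℚ
      aq≢0 a≢0 e = q≢0 (*≡0⇒≡0 a≢0 e)

      -- A recurrent state `c` that can reach 0 passes its recurrence on. Its censored row and its
      -- original row both sum to 1, so `row-sum` forces `loss` to vanish; closedness of the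
      -- censored chain kills the detour from `c` through 0 to a transient `d`, whose first factors
      -- are nonzero.
      recurrent₀ : ∀ c → transient c ≡ false → A (suc c) zero ≢ 0ℚ → Recurrent₀
      recurrent₀ c tc a≢0 = sym (-≡0⇒≡ loss≡0) , λ d td →
        *≡0⇒≡0 (aq≢0 a≢0) (+≡0⇒≡0ʳ (0≤A _ _) (0≤* (0≤aq c) (0≤A _ _)) (recurrent-closed c d tc td))
        where
        open GroupProperties ℚ.+-0-group using (∙-cancelˡ)
        loss≡0 : loss ≡ 0ℚ
        loss≡0 = *≡0⇒≡0 (aq≢0 a≢0) (∙-cancelˡ (sum (A′ c)) _ _
          (trans (row-sum c) (trans (row′≡1 c tc) (sym (trans (ℚ.+-identityʳ _) (recurrent-row c tc))))))

      T : Fin (suc n) → Bool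
      T zero    = not (does recurrent₀?)
      T (suc c) = transient c

      T₀-false : T zero ≡ false → Recurrent₀
      T₀-false = does-true recurrent₀?

      a₀-closed : ∀ c → transient c ≡ false → T zero ≡ true → A (suc c) zero ≡ 0ℚ
      a₀-closed c tc t₀ = decidable-stable (A (suc c) zero ℚ.≟ 0ℚ)
        (does-false recurrent₀? t₀ ∘ recurrent₀ c tc)

      module Solve (u : Fin (suc n) → ℚ) (0≤u : ∀ c → 0ℚ ≤ u c) (su : SupportedOn T u) where

        -- The source of the censored system: eliminating `V zero` from the remaining equations adds
        -- the part of `u zero` that is reached from `c` through state 0.
        u′ : Fin n → ℚ
        u′ c = u (suc c) + A (suc c) zero * q * u zero

        -- Keeps the new source supported on transient states: either 0 is recurrent and `u`
        -- vanishes there, or 0 is transient and the recurrent `c` cannot reach it.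
        a*u₀≡0 : ∀ c → transient c ≡ false → A (suc c) zero * q * u zero ≡ 0ℚ
        a*u₀≡0 c tc = cases (T zero) refl
          where
          cases : ∀ t₀ → T zero ≡ t₀ → A (suc c) zero * q * u zero ≡ 0ℚ
          cases false e = trans (cong (A (suc c) zero * q *_) (su zero e)) (ℚ.*-zeroʳ (A (suc c) zero * q))
          cases true  e = trans (cong (λ a → a * q * u zero) (a₀-closed c tc e))
                        (trans (cong (_* u zero) (ℚ.*-zeroˡ q)) (ℚ.*-zeroˡ (u zero)))

        rest = potential u′ (λ c → 0≤+ (0≤u (suc c)) (0≤* (0≤aq c) (0≤u zero)))
          (λ c tc → trans (cong₂ _+_ (su (suc c) tc) (a*u₀≡0 c tc)) (ℚ.+-identityʳ 0ℚ))
        V′ = proj₁ rest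
        0≤V′ = proj₁ (proj₂ rest)
        sV′ = proj₁ (proj₂ (proj₂ rest))
        eV′ = proj₂ (proj₂ (proj₂ rest))

        m₀ = sum (λ d → A zero (suc d) * V′ d)

        V : Fin (suc n) → ℚ
        V zero    = q * (u zero + m₀)
        V (suc c) = V′ c

        0≤V : ∀ c → 0ℚ ≤ V c
        0≤V zero    = 0≤* 0≤q (0≤+ (0≤u zero) (sum-nonNegative n (λ d → 0≤* (0≤A zero (suc d)) (0≤V′ d))))
        0≤V (suc c) = 0≤V′ c

        sV : SupportedOn T V
        sV (suc c) tc = sV′ c tc
        sV zero    t₀ = trans (cong (q *_) (trans (cong₂ _+_ (su zero t₀) (sum-zero n product≡0)) (ℚ.+-identityʳ 0ℚ))) (ℚ.*-zeroʳ q)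
          where
          product≡0 : ∀ d → A zero (suc d) * V′ d ≡ 0ℚ
          product≡0 d = cases (transient d) refl
            where
            cases : ∀ t → transient d ≡ t → A zero (suc d) * V′ d ≡ 0ℚ
            cases false td = trans (cong (A zero (suc d) *_) (sV′ d td)) (ℚ.*-zeroʳ (A zero (suc d)))
            cases true  td = trans (cong (_* V′ d) (proj₂ (T₀-false t₀) d td)) (ℚ.*-zeroˡ (V′ d))

        eV : ∀ c → V c ≡ u c + sum (λ d → A c d * V d)
        eV zero = begin
          q * (u zero + m₀)
            -- Here `q` is split as `q * (1ℚ - a₀₀) + q * a₀₀`. The number `1ℚ` is passed as a
            -- variable `o` so that the term `q * (1ℚ - a₀₀)` appears literally; the last summand,
            -- which is zero, compensates for this.
            ≡⟨ solve 4 (λ q o z x → q :* x := (q :* (o :- z)) :* x :+ (z :* (q :* x) :+ (con 1ℚ :- o) :* (q :* x))) refl q 1ℚ a₀₀ (u zero + m₀) ⟩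
          q * (1ℚ - a₀₀) * (u zero + m₀) + (a₀₀ * (q * (u zero + m₀)) + (1ℚ - 1ℚ) * (q * (u zero + m₀)))
            ≡⟨ cong₂ (λ x y → x * (u zero + m₀) + (a₀₀ * (q * (u zero + m₀)) + y)) q-inverse (ℚ.*-zeroˡ (q * (u zero + m₀))) ⟩
          1ℚ * (u zero + m₀) + (a₀₀ * (q * (u zero + m₀)) + 0ℚ)
            ≡⟨ solve 4 (λ u m z q → con 1ℚ :* (u :+ m) :+ (z :* (q :* (u :+ m)) :+ con 0ℚ) := u :+ (z :* (q :* (u :+ m)) :+ m)) refl (u zero) m₀ a₀₀ q ⟩
          u zero + (a₀₀ * (q * (u zero + m₀)) + m₀) ∎
          where open ≡-Reasoning
        eV (suc c) = begin
          V′ c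
            ≡⟨ eV′ c ⟩
          u′ c + sum (λ d → A′ c d * V′ d)
            ≡⟨ cong (u′ c +_) (Σℚ.sum-cong-≋ {n} (λ d → solve 4 (λ x y z v → (x :+ y :* z) :* v := x :* v :+ y :* (z :* v)) refl (A (suc c) (suc d)) (a * q) (A zero (suc d)) (V′ d))) ⟩
          u′ c + sum (λ d → A (suc c) (suc d) * V′ d + a * q * (A zero (suc d) * V′ d))
            ≡⟨ cong (u′ c +_) (Σℚ.∑-distrib-+ {n} (λ d → A (suc c) (suc d) * V′ d) (λ d → a * q * (A zero (suc d) * V′ d))) ⟩
          u′ c + (m + sum (λ d → a * q * (A zero (suc d) * V′ d)))
            ≡⟨ cong (λ z → u′ c + (m + z)) (Σℚ.*-distribˡ-sum {n} (a * q) (λ d → A zero (suc d) * V′ d)) ⟨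
          u (suc c) + a * q * u zero + (m + a * q * m₀)
            ≡⟨ solve 6 (λ uc a q u₀ m m₀ → uc :+ a :* q :* u₀ :+ (m :+ a :* q :* m₀) := uc :+ (a :* (q :* (u₀ :+ m₀)) :+ m)) refl (u (suc c)) a q (u zero) m m₀ ⟩
          u (suc c) + (a * (q * (u zero + m₀)) + m) ∎
          where
          open ≡-Reasoning
          a = A (suc c) zero
          m = sum (λ d → A (suc c) (suc d) * V′ d)

      extend : Transience A
      extend = record
        { transient = T
        ; recurrent-row = λ { zero t₀ → proj₁ (T₀-false t₀) ; (suc c) tc → row′≡1 c tc }
        ; recurrent-closed = λ
          { zero    zero    t₀ t₀′ → contradiction (trans (sym t₀) t₀′) λ ()
          ; zero    (suc d) t₀ td  → proj₂ (T₀-false t₀) d td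
          ; (suc c) zero    tc t₀  → a₀-closed c tc t₀
          ; (suc c) (suc d) tc td  → +≡0⇒≡0ˡ (0≤A _ _) (0≤* (0≤aq c) (0≤A _ _)) (recurrent-closed c d tc td)
          }
        ; potential = λ u 0≤u su → let open Solve u 0≤u su in V , 0≤V , sV , eV
        }

  -- Recursion on the number of states. Equality of rationals is decidable, so it can be decided
  -- whether 1 - a₀₀ is invertible.
  transience : ∀ {n} (A : Fin n → Fin n → ℚ) → IsSubstochastic A → Transience A
  transience {zero} A sub = record
    { transient = λ ()
    ; recurrent-row = λ ()
    ; recurrent-closed = λ ()
    ; potential = λ u _ _ → u , (λ ()) , (λ ()) , (λ ())
    }
  transience {suc n} A sub with A zero zero ℚ.≟ 1ℚ
  ... | yes a₀₀≡1 = AbsorbingState.extend A sub a₀₀≡1 (transience _ (AbsorbingState.substochastic A sub a₀₀≡1))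
  ... | no  a₀₀≢1 = Censoring.extend A sub a₀₀≢1 (transience _ (Censoring.substochastic A sub a₀₀≢1))

  -- Partial sums and Archimedean bounds

  partialSum : (ℕ → ℚ) → ℕ → ℚ
  partialSum f zero    = 0ℚ
  partialSum f (suc K) = f 0 + partialSum (f ∘ suc) K

  fromℕ : ℕ → ℚ
  fromℕ N = ℚ.mkℚ (ℤ.+ N) 0 (∣1⇒≡1 ∘ proj₂)

  1+fromℕ : ∀ N → fromℕ (suc N) ≡ 1ℚ + fromℕ N
  1+fromℕ N = ℚ.toℚᵘ-injective (ℚᵘ.≃-trans (ℚᵘ.*≡* (cong (ℤ._* ℤ.1ℤ) (sym (cong (λ x → ℤ.1ℤ ℤ.+ x) (ℤ.*-identityʳ (ℤ.+ N))))))
    (ℚᵘ.≃-sym (ℚ.toℚᵘ-homo-+ 1ℚ (fromℕ N))))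

  fromℕ-· : ∀ N ε → fromℕ N * ε ≡ N · ε
  fromℕ-· zero    ε = ℚ.*-zeroˡ ε
  fromℕ-· (suc N) ε = trans (cong (_* ε) (1+fromℕ N)) (trans (ℚ.*-distribʳ-+ ε 1ℚ (fromℕ N))
    (cong₂ _+_ (ℚ.*-identityˡ ε) (fromℕ-· N ε)))

  -- A nonnegative fraction is at most its numerator, since the denominator is at least 1.
  ≤numerator : ∀ p → ∃ λ N → p ≤ fromℕ N
  ≤numerator (ℚ.mkℚ (ℤ.+ N) d _) = N , ℚ.*≤* (ℤ.*-monoˡ-≤-nonNeg (ℤ.+ N) (ℤ.+≤+ (s≤s z≤n)))
  ≤numerator (ℚ.mkℚ ℤ.-[1+ N ] d _) = 0 , ℚ.*≤* ℤ.-≤+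

  archimedean : ∀ H {ε} → 0ℚ < ε → ∃ λ N → H ≤ N · ε
  archimedean H {ε} 0<ε =
    let q , 0≤q , _ , qε≡1 = reciprocal (ℚ.<⇒≤ 0<ε) (λ e → ℚ.<⇒≢ 0<ε (sym e))
        N , Hq≤N = ≤numerator (H * q)
    in N , (begin
      H                  ≡⟨ ℚ.*-identityʳ H ⟨
      H * 1ℚ             ≡⟨ cong (H *_) qε≡1 ⟨
      H * (q * ε)        ≡⟨ ℚ.*-assoc H q ε ⟨
      H * q * ε          ≤⟨ ℚ.*-monoʳ-≤-nonNeg ε {{ℚ.nonNegative (ℚ.<⇒≤ 0<ε)}} Hq≤N ⟩
      fromℕ N * ε  ≡⟨ fromℕ-· N ε ⟩
      N · ε              ∎)
    where open ℚ.≤-Reasoning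

  ·-monoʳ-≤ : ∀ N {x y} → x ≤ y → N · x ≤ N · y
  ·-monoʳ-≤ zero    x≤y = ℚ.≤-refl
  ·-monoʳ-≤ (suc N) x≤y = ℚ.+-mono-≤ x≤y (·-monoʳ-≤ N x≤y)

  ·-monoˡ-≤ : ∀ {M N x} → 0ℚ ≤ x → M ℕ.≤ N → M · x ≤ N · x
  ·-monoˡ-≤ {N = zero}  0≤x z≤n       = ℚ.≤-refl
  ·-monoˡ-≤ {N = suc N} 0≤x z≤n       = 0≤+ 0≤x (·-monoˡ-≤ {N = N} 0≤x z≤n)
  ·-monoˡ-≤ {x = x}     0≤x (s≤s M≤N) = ℚ.+-monoʳ-≤ x (·-monoˡ-≤ 0≤x M≤N)

  -- Convergence of the series of the A^k b with an explicit modulus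

  module Convergence {n} (A : Fin n → Fin n → ℚ) (sub : IsSubstochastic A) (b : Fin n → ℚ)
    (0≤b : ∀ c → 0ℚ ≤ b c) (b≤loss : ∀ c → sum (A c) + b c ≤ 1ℚ) where

    open Transience (transience A sub)

    infix 8 _▹_
    _▹_ : (Fin n → Fin n → ℚ) → (Fin n → ℚ) → Fin n → ℚ
    (B ▹ v) c = sum (λ d → B c d * v d)

    ▹-mono : ∀ {u v} → (∀ c → u c ≤ v c) → ∀ c → (A ▹ u) c ≤ (A ▹ v) c
    ▹-mono u≤v c = sum-mono n (λ d → ℚ.*-monoˡ-≤-nonNeg (A c d) {{ℚ.nonNegative (proj₁ sub c d)}} (u≤v d))

    ▹-+ : ∀ u v c → (A ▹ (λ d → u d + v d)) c ≡ (A ▹ u) c + (A ▹ v) c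
    ▹-+ u v c = trans (Σℚ.sum-cong-≋ {n} (λ d → ℚ.*-distribˡ-+ (A c d) (u d) (v d)))
      (Σℚ.∑-distrib-+ {n} (λ d → A c d * u d) (λ d → A c d * v d))

    -- A recurrent row already has sum 1, which leaves no room for `b`; this makes `potential`
    -- applicable to `b`.
    b-supported : SupportedOn transient b
    b-supported c tc = ℚ.≤-antisym
      (+-cancelˡ-≤ (sum (A c)) (subst (sum (A c) + b c ≤_) (sym (trans (ℚ.+-identityʳ (sum (A c))) (recurrent-row c tc))) (b≤loss c)))
      (0≤b c)

    V-potential = potential b 0≤b b-supported
    V = proj₁ V-potential
    0≤V = proj₁ (proj₂ V-potential)
    V-equation : ∀ c → V c ≡ b c + (A ▹ V) c
    V-equation = proj₂ (proj₂ (proj₂ V-potential))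

    h-potential = potential V 0≤V (proj₁ (proj₂ (proj₂ V-potential)))
    h = proj₁ h-potential
    0≤h = proj₁ (proj₂ h-potential)
    h-equation : ∀ c → h c ≡ V c + (A ▹ h) c
    h-equation = proj₂ (proj₂ (proj₂ h-potential))

    power : (Fin n → ℚ) → ℕ → Fin n → ℚ
    power v zero    = v
    power v (suc K) = A ▹ power v K

    ▹-nonNegative : ∀ {v} → (∀ c → 0ℚ ≤ v c) → ∀ c → 0ℚ ≤ (A ▹ v) c
    ▹-nonNegative 0≤v c = sum-nonNegative n (λ d → 0≤* (proj₁ sub c d) (0≤v d))

    power-nonNegative : ∀ {v} → (∀ c → 0ℚ ≤ v c) → ∀ K c → 0ℚ ≤ power v K c
    power-nonNegative 0≤v zero    = 0≤v
    power-nonNegative 0≤v (suc K) = ▹-nonNegative (power-nonNegative 0≤v K)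

    -- The first step is `V` minus `A ▹ V`, which is `b` and so nonnegative; monotonicity of `A`
    -- carries it to all powers.
    V-decreasing : ∀ K c → power V (suc K) c ≤ power V K c
    V-decreasing zero    c = subst ((A ▹ V) c ≤_) (sym (V-equation c)) (≤+ˡ _ (0≤b c))
    V-decreasing (suc K) c = ▹-mono (V-decreasing K) c

    h-splits : ∀ K c → power h K c ≡ power V K c + power h (suc K) c
    h-splits zero    c = h-equation c
    h-splits (suc K) c = trans (Σℚ.sum-cong-≋ {n} (λ d → cong (A c d *_) (h-splits K d)))
      (▹-+ (power V K) (power h (suc K)) c)

    -- h = Σ_{k<K} A^k V + A^K h, and the terms A^k V decrease.
    remainder-bound′ : ∀ K c → K · power V K c + power h K c ≤ h c
    remainder-bound′ zero    c = ℚ.≤-reflexive (ℚ.+-identityˡ (h c))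
    remainder-bound′ (suc K) c = begin
      suc K · power V (suc K) c + power h (suc K) c
        ≤⟨ ℚ.+-monoˡ-≤ (power h (suc K) c) (·-monoʳ-≤ (suc K) (V-decreasing K c)) ⟩
      power V K c + K · power V K c + power h (suc K) c
        ≡⟨ solve 3 (λ x y z → x :+ y :+ z := y :+ (x :+ z)) refl (power V K c) (K · power V K c) (power h (suc K) c) ⟩
      K · power V K c + (power V K c + power h (suc K) c)
        ≡⟨ cong (K · power V K c +_) (h-splits K c) ⟨
      K · power V K c + power h K c
        ≤⟨ remainder-bound′ K c ⟩
      h c ∎
      where open ℚ.≤-Reasoning

    remainder-bound : ∀ K c → K · power V K c ≤ h c
    remainder-bound K c = ℚ.≤-trans (≤+ʳ _ (power-nonNegative 0≤h K c)) (remainder-bound′ K c)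

    module _ (f : Fin n → ℕ → ℚ) (f₀ : ∀ c → f c 0 ≡ 0ℚ) (f₁ : ∀ c → f c 1 ≡ b c)
             (f₊ : ∀ c k → f c (suc (suc k)) ≡ sum (λ d → A c d * f d (suc k))) where

      S : ℕ → Fin n → ℚ
      S K c = partialSum (λ k → f c (suc k)) K

      partialSum-▹ : ∀ (g : Fin n → ℕ → ℚ) (g′ : ℕ → ℚ) c → (∀ k → g′ k ≡ sum (λ d → A c d * g d k)) →
        ∀ K → partialSum g′ K ≡ (A ▹ (λ d → partialSum (g d) K)) c
      partialSum-▹ g g′ c e zero    = sym (sum-zero n (λ d → ℚ.*-zeroʳ (A c d)))
      partialSum-▹ g g′ c e (suc K) = trans (cong₂ _+_ (e 0) (partialSum-▹ (λ d → g d ∘ suc) (g′ ∘ suc) c (e ∘ suc) K))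
        (sym (▹-+ (λ d → g d 0) (λ d → partialSum (g d ∘ suc) K) c))

      -- Iterates V = b + A V: the sums satisfy the same recursion, S (K + 1) = b + A S K, and the
      -- remainder is A^K V.
      V-splits : ∀ K c → V c ≡ S K c + power V K c
      V-splits zero    c = sym (ℚ.+-identityˡ (V c))
      V-splits (suc K) c = begin
        V c ≡⟨ V-equation c ⟩
        b c + (A ▹ V) c
          ≡⟨ cong (b c +_) (Σℚ.sum-cong-≋ {n} (λ d → cong (A c d *_) (V-splits K d))) ⟩
        b c + (A ▹ (λ d → S K d + power V K d)) c
          ≡⟨ cong (b c +_) (▹-+ (S K) (power V K) c) ⟩
        b c + ((A ▹ S K) c + power V (suc K) c)
          ≡⟨ ℚ.+-assoc (b c) ((A ▹ S K) c) (power V (suc K) c) ⟨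
        b c + (A ▹ S K) c + power V (suc K) c
          ≡⟨ cong₂ (λ x y → x + y + power V (suc K) c) (f₁ c) (partialSum-▹ (λ d k → f d (suc k)) (λ k → f c (suc (suc k))) c (f₊ c) K) ⟨
        S (suc K) c + power V (suc K) c ∎
        where open ≡-Reasoning

      remainder-small : ∀ {ε} → 0ℚ < ε → ∀ c → ∃ λ N → ∀ K → N ℕ.≤ K → power V K c ≤ ε
      -- A remainder above `ε` would give (N + 1) ε < (N + 1) r ≤ K r ≤ h ≤ N ε. Taking `suc N`
      -- copies guarantees at least one, so that the first inequality is strict.
      remainder-small {ε} 0<ε c = suc N , λ K N<K → ℚ.≮⇒≥ λ ε<r → ℚ.<-irrefl refl (ℚ.<-≤-trans (<-bound K ε<r) (begin
        suc N · power V K c ≤⟨ ·-monoˡ-≤ (power-nonNegative 0≤V K c) N<K ⟩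
        K · power V K c     ≤⟨ remainder-bound K c ⟩
        h c                 ≤⟨ h≤Nε ⟩
        N · ε               ≤⟨ ≤+ˡ (N · ε) (ℚ.<⇒≤ 0<ε) ⟩
        suc N · ε           ∎))
        where
        open ℚ.≤-Reasoning
        N = proj₁ (archimedean (h c) 0<ε)
        h≤Nε = proj₂ (archimedean (h c) 0<ε)
        <-bound : ∀ K → ε < power V K c → suc N · ε < suc N · power V K c
        <-bound K ε<r = ℚ.+-mono-<-≤ ε<r (·-monoʳ-≤ N (ℚ.<⇒≤ ε<r))

      convergence : ∀ {ε} → 0ℚ < ε → ∀ c → ∃ λ N → ∀ K → N ℕ.≤ K →
        partialSum (f c) K ≤ V c × V c ≤ partialSum (f c) K + ε
      -- The index moves up by one because coefficient 0 of `f c` is zero: `suc K` coefficients of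
      -- `f c` sum to `S K c`.
      convergence {ε} 0<ε c = suc N , λ { (suc K) (s≤s N≤K) → bounds K N≤K }
        where
        N = proj₁ (remainder-small 0<ε c)
        bounds : ∀ K → N ℕ.≤ K → partialSum (f c) (suc K) ≤ V c × V c ≤ partialSum (f c) (suc K) + ε
        bounds K N≤K = subst (λ s → s ≤ V c × V c ≤ s + ε)
          (sym (trans (cong (_+ S K c) (f₀ c)) (ℚ.+-identityˡ (S K c))))
          ( subst (S K c ≤_) (sym (V-splits K c)) (≤+ʳ (S K c) (power-nonNegative 0≤V K c))
          , subst (_≤ S K c + ε) (sym (V-splits K c)) (ℚ.+-monoʳ-≤ (S K c) (proj₂ (remainder-small 0<ε c) K N≤K)))

-- The commutative ring of real numbers

module Reals where

  open import Defs
  open +-*-Solver using (solve; _:+_; _:*_; _:-_; :-_; _:=_)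

  -- By definition `x ≈ y` says that the distance of the two sequences is `Small`, so the closure
  -- properties of `Small` yield the laws of real equality.
  Small : (ℕ → ℚ) → Set
  Small u = ∀ ε → 0ℚ ℚ.< ε → ∃ λ N → ∀ i → N ℕ.≤ i → u i ℚ.≤ ε

  small-≤ : ∀ {u v} → (∀ i → u i ℚ.≤ v i) → Small v → Small u
  small-≤ u≤v v-small ε 0<ε = let N , v≤ε = v-small ε 0<ε in N , λ i N≤i → ℚ.≤-trans (u≤v i) (v≤ε i N≤i)

  half-positive : ∀ {ε} → 0ℚ ℚ.< ε → 0ℚ ℚ.< ε ℚ.* ½
  half-positive {ε} 0<ε = ℚ.positive⁻¹ _ {{ℚ.pos*pos⇒pos ε {{ℚ.positive 0<ε}} ½}}

  halves : ∀ ε → ε ℚ.* ½ ℚ.+ ε ℚ.* ½ ≡ ε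
  halves ε = ≡.trans (≡.sym (ℚ.*-distribˡ-+ ε ½ ½)) (ℚ.*-identityʳ ε)

  small-+ : ∀ {u v} → Small u → Small v → Small (λ i → u i ℚ.+ v i)
  small-+ {u} {v} u-small v-small ε 0<ε =
    let M , u≤ = u-small (ε ℚ.* ½) (half-positive 0<ε)
        N , v≤ = v-small (ε ℚ.* ½) (half-positive 0<ε)
    in M ℕ.⊔ N , λ i M⊔N≤i → ≡.subst (u i ℚ.+ v i ℚ.≤_) (halves ε)
      (ℚ.+-mono-≤ (u≤ i (ℕ.m⊔n≤o⇒m≤o M N M⊔N≤i)) (v≤ i (ℕ.m⊔n≤o⇒n≤o M N M⊔N≤i)))

  bounded : ∀ x → ∃ λ B → 0ℚ ℚ.< B × ∃ λ N → ∀ i → N ℕ.≤ i → ∣ seq x i ∣ ℚ.≤ B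
  bounded x = 1ℚ ℚ.+ ∣ seq x N ∣ , ℚ.+-mono-<-≤ (ℚ.positive⁻¹ 1ℚ) (ℚ.0≤∣p∣ (seq x N)) , N , λ i N≤i → begin
      ∣ seq x i ∣                                  ≡⟨ ≡.cong ∣_∣ (regroup (seq x i) (seq x N)) ⟩
      ∣ (seq x i ℚ.- seq x N) ℚ.+ seq x N ∣        ≤⟨ ℚ.∣p+q∣≤∣p∣+∣q∣ (seq x i ℚ.- seq x N) (seq x N) ⟩
      ∣ seq x i ℚ.- seq x N ∣ ℚ.+ ∣ seq x N ∣      ≤⟨ ℚ.+-monoˡ-≤ ∣ seq x N ∣ (proj₂ close i N N≤i ℕ.≤-refl) ⟩
      1ℚ ℚ.+ ∣ seq x N ∣                           ∎
    where
    open ℚ.≤-Reasoning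
    close = cauchy x 1ℚ (ℚ.positive⁻¹ 1ℚ)
    N = proj₁ close
    regroup : ∀ a b → a ≡ (a ℚ.- b) ℚ.+ b
    regroup = solve 2 (λ a b → a := (a :- b) :+ b) ≡.refl

  small-* : ∀ {d} x → Small (∣_∣ ∘ d) → Small (λ i → ∣ d i ℚ.* seq x i ∣)
  small-* {d} x d-small ε 0<ε =
    let B , 0<B , M , x≤B = bounded x
        instance
          B>0 = ℚ.positive 0<B
          B≢0 = ℚ.pos⇒nonZero B
        -- Dividing by the eventual bound `B` of `x` makes the product at most `ε`.
        δ = ε ℚ.* ℚ.1/ B
        0<δ = ℚ.positive⁻¹ δ {{ℚ.pos*pos⇒pos ε {{ℚ.positive 0<ε}} (ℚ.1/ B) {{ℚ.1/pos⇒pos B}}}}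
        N , d≤δ = d-small δ 0<δ
    in M ℕ.⊔ N , λ i M⊔N≤i → begin
      ∣ d i ℚ.* seq x i ∣       ≡⟨ ℚ.∣p*q∣≡∣p∣*∣q∣ (d i) (seq x i) ⟩
      ∣ d i ∣ ℚ.* ∣ seq x i ∣   ≤⟨ ℚ.*-monoʳ-≤-nonNeg ∣ seq x i ∣ {{ℚ.nonNegative (ℚ.0≤∣p∣ (seq x i))}} (d≤δ i (ℕ.m⊔n≤o⇒n≤o M N M⊔N≤i)) ⟩
      δ ℚ.* ∣ seq x i ∣         ≤⟨ ℚ.*-monoˡ-≤-nonNeg δ {{ℚ.nonNegative (ℚ.<⇒≤ 0<δ)}} (x≤B i (ℕ.m⊔n≤o⇒m≤o M N M⊔N≤i)) ⟩
      δ ℚ.* B                   ≡⟨ ℚ.*-assoc ε (ℚ.1/ B) B ⟩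
      ε ℚ.* (ℚ.1/ B ℚ.* B)      ≡⟨ ≡.cong (ε ℚ.*_) (ℚ.*-inverseˡ B) ⟩
      ε ℚ.* 1ℚ                  ≡⟨ ℚ.*-identityʳ ε ⟩
      ε                         ∎
    where open ℚ.≤-Reasoning

  pointwise : ∀ {x y} → (∀ i → seq x i ≡ seq y i) → x ≈ y
  pointwise {x} {y} x≡y ε 0<ε = 0 , λ i _ → ≡.subst (ℚ._≤ ε)
    (≡.cong ∣_∣ (≡.sym (≡.trans (≡.cong (ℚ._- seq y i) (x≡y i)) (ℚ.+-inverseʳ (seq y i))))) (ℚ.<⇒≤ 0<ε)

  ≈-refl : ∀ {x} → x ≈ x
  ≈-refl {x} = pointwise {x} {x} (λ _ → ≡.refl)

  ∣-∣-sym : ∀ a b → ∣ a ℚ.- b ∣ ≡ ∣ b ℚ.- a ∣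
  ∣-∣-sym a b = ≡.trans (≡.cong ∣_∣ (solve 2 (λ a b → a :- b := :- (b :- a)) ≡.refl a b)) (ℚ.∣-p∣≡∣p∣ (b ℚ.- a))

  ≈-sym : ∀ {x y} → x ≈ y → y ≈ x
  ≈-sym {x} {y} = small-≤ (λ i → ℚ.≤-reflexive (∣-∣-sym (seq y i) (seq x i)))

  ≈-trans : ∀ {x y z} → x ≈ y → y ≈ z → x ≈ z
  ≈-trans {x} {y} {z} x≈y y≈z = small-≤ (λ i → triangle (seq x i) (seq y i) (seq z i)) (small-+ x≈y y≈z)
    where
    triangle : ∀ a b c → ∣ a ℚ.- c ∣ ℚ.≤ ∣ a ℚ.- b ∣ ℚ.+ ∣ b ℚ.- c ∣
    triangle a b c = ≡.subst (λ t → ∣ t ∣ ℚ.≤ ∣ a ℚ.- b ∣ ℚ.+ ∣ b ℚ.- c ∣)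
      (solve 3 (λ a b c → (a :- b) :+ (b :- c) := a :- c) ≡.refl a b c)
      (ℚ.∣p+q∣≤∣p∣+∣q∣ (a ℚ.- b) (b ℚ.- c))

  +-cong : ∀ {x y u v} → x ≈ y → u ≈ v → x + u ≈ y + v
  +-cong {x} {y} {u} {v} x≈y u≈v =
    small-≤ (λ i → triangle (seq x i) (seq y i) (seq u i) (seq v i)) (small-+ x≈y u≈v)
    where
    triangle : ∀ a b c d → ∣ (a ℚ.+ c) ℚ.- (b ℚ.+ d) ∣ ℚ.≤ ∣ a ℚ.- b ∣ ℚ.+ ∣ c ℚ.- d ∣
    triangle a b c d = ≡.subst (λ t → ∣ t ∣ ℚ.≤ ∣ a ℚ.- b ∣ ℚ.+ ∣ c ℚ.- d ∣)
      (solve 4 (λ a b c d → (a :- b) :+ (c :- d) := (a :+ c) :- (b :+ d)) ≡.refl a b c d)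
      (ℚ.∣p+q∣≤∣p∣+∣q∣ (a ℚ.- b) (c ℚ.- d))

  *-congʳ : ∀ {x y} z → x ≈ y → x * z ≈ y * z
  *-congʳ {x} {y} z x≈y = small-≤ (λ i → ℚ.≤-reflexive (≡.cong ∣_∣ (factor (seq x i) (seq y i) (seq z i)))) (small-* z x≈y)
    where
    factor : ∀ a b c → a ℚ.* c ℚ.- b ℚ.* c ≡ (a ℚ.- b) ℚ.* c
    factor = solve 3 (λ a b c → a :* c :- b :* c := (a :- b) :* c) ≡.refl

  *-comm : ∀ x y → x * y ≈ y * x
  *-comm x y = pointwise {x * y} {y * x} (λ i → ℚ.*-comm (seq x i) (seq y i))

  *-cong : ∀ {x y u v} → x ≈ y → u ≈ v → x * u ≈ y * v
  *-cong {x} {y} {u} {v} x≈y u≈v = ≈-trans {x * u} {y * u} {y * v} (*-congʳ {x} {y} u x≈y)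
    (≈-trans {y * u} {u * y} {y * v} (*-comm y u)
      (≈-trans {u * y} {v * y} {y * v} (*-congʳ {u} {v} y u≈v) (*-comm v y)))

  ∣neg-neg∣ : ∀ a b → ∣ (ℚ.- a) ℚ.- (ℚ.- b) ∣ ≡ ∣ a ℚ.- b ∣
  ∣neg-neg∣ a b = ≡.trans (≡.cong ∣_∣ (solve 2 (λ a b → (:- a) :- (:- b) := :- (a :- b)) ≡.refl a b)) (ℚ.∣-p∣≡∣p∣ (a ℚ.- b))

  negate : ℝ → ℝ
  negate x = mkℝ (λ i → ℚ.- seq x i) λ ε 0<ε → let N , close = cauchy x ε 0<ε in
    N , λ i j N≤i N≤j → ≡.subst (ℚ._≤ ε) (≡.sym (∣neg-neg∣ (seq x i) (seq x j))) (close i j N≤i N≤j)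

  realRing : CommutativeRing 0ℓ 0ℓ
  realRing = record
    { Carrier = ℝ
    ; _≈_ = _≈_
    ; _+_ = _+_
    ; _*_ = _*_
    ; -_ = negate
    ; 0# = 0ℝ
    ; 1# = 1ℝ
    ; isCommutativeRing = record
      { isRing = record
        { +-isAbelianGroup = record
          { isGroup = record
            { isMonoid = record
              { isSemigroup = record
                { isMagma = record
                  { isEquivalence = record
                    { refl  = λ {x} → ≈-refl {x}
                    ; sym   = λ {x} {y} → ≈-sym {x} {y}
                    ; trans = λ {x} {y} {z} → ≈-trans {x} {y} {z}
                    }
                  ; ∙-cong = λ {x} {y} {u} {v} → +-cong {x} {y} {u} {v}
                  }
                ; assoc = λ x y z → pointwise {x + y + z} {x + (y + z)} (λ i → ℚ.+-assoc (seq x i) (seq y i) (seq z i))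
                }
              ; identity = (λ x → pointwise {0ℝ + x} {x} (λ i → ℚ.+-identityˡ (seq x i)))
                         , (λ x → pointwise {x + 0ℝ} {x} (λ i → ℚ.+-identityʳ (seq x i)))
              }
            ; inverse = (λ x → pointwise {negate x + x} {0ℝ} (λ i → ℚ.+-inverseˡ (seq x i)))
                      , (λ x → pointwise {x + negate x} {0ℝ} (λ i → ℚ.+-inverseʳ (seq x i)))
            ; ⁻¹-cong = λ {x} {y} → small-≤ (λ i → ℚ.≤-reflexive (∣neg-neg∣ (seq x i) (seq y i)))
            }
          ; comm = λ x y → pointwise {x + y} {y + x} (λ i → ℚ.+-comm (seq x i) (seq y i))
          }
        ; *-cong = λ {x} {y} {u} {v} → *-cong {x} {y} {u} {v}
        ; *-assoc = λ x y z → pointwise {x * y * z} {x * (y * z)} (λ i → ℚ.*-assoc (seq x i) (seq y i) (seq z i))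
        ; *-identity = (λ x → pointwise {1ℝ * x} {x} (λ i → ℚ.*-identityˡ (seq x i)))
                     , (λ x → pointwise {x * 1ℝ} {x} (λ i → ℚ.*-identityʳ (seq x i)))
        ; distrib = (λ x y z → pointwise {x * (y + z)} {x * y + x * z} (λ i → ℚ.*-distribˡ-+ (seq x i) (seq y i) (seq z i)))
                  , (λ x y z → pointwise {(y + z) * x} {y * x + z * x} (λ i → ℚ.*-distribʳ-+ (seq x i) (seq y i) (seq z i)))
        }
      ; *-comm = *-comm
      }
    }

  -- If b < a, a rational strictly between them is a choice of b + ε that lies below a.
  ≤-limit : ∀ {a b} → (∀ ε → 0ℚ ℚ.< ε → a ℚ.≤ b ℚ.+ ε) → a ℚ.≤ b
  ≤-limit {a} {b} a≤b+ε = ℚ.≮⇒≥ λ b<a →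
    let m , b<m , m<a = ℚ.<-dense b<a
    in ℚ.<-irrefl ≡.refl (ℚ.<-≤-trans m<a (≡.subst (a ℚ.≤_) (solve 2 (λ b m → b :+ (m :- b) := m) ≡.refl b m)
      (a≤b+ε (m ℚ.- b) (≡.subst (ℚ._< m ℚ.- b) (ℚ.+-inverseʳ b) (ℚ.+-monoˡ-< (ℚ.- b) b<m)))))

  ∣-∣≤⇒≤+ : ∀ {a b ε} → ∣ a ℚ.- b ∣ ℚ.≤ ε → a ℚ.≤ b ℚ.+ ε
  ∣-∣≤⇒≤+ {a} {b} {ε} a-b≤ε = ≡.subst (ℚ._≤ b ℚ.+ ε) (solve 2 (λ a b → b :+ (a :- b) := a) ≡.refl a b)
    (ℚ.+-monoʳ-≤ b (ℚ.≤-trans (p≤∣p∣ (a ℚ.- b)) a-b≤ε))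
    where
    p≤∣p∣ : ∀ p → p ℚ.≤ ∣ p ∣
    p≤∣p∣ p = [ (λ 0≤p → ℚ.≤-reflexive (≡.sym (ℚ.0≤p⇒∣p∣≡p 0≤p))) , (λ p≤0 → ℚ.≤-trans p≤0 (ℚ.0≤∣p∣ p)) ]′ (ℚ.≤-total 0ℚ p)

  fromℚ-injective : ∀ {a b} → fromℚ a ≈ fromℚ b → a ≡ b
  fromℚ-injective {a} {b} a≈b = ℚ.≤-antisym
    (≤-limit λ ε 0<ε → let N , close = a≈b ε 0<ε in ∣-∣≤⇒≤+ (close N ℕ.≤-refl))
    (≤-limit λ ε 0<ε → let N , close = ≈-sym {fromℚ a} {fromℚ b} a≈b ε 0<ε in ∣-∣≤⇒≤+ (close N ℕ.≤-refl))

  nonNegative-fromℚ : ∀ {x q} → 0ℝ ≤ x → x ≈ fromℚ q → 0ℚ ℚ.≤ q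
  nonNegative-fromℚ {x} {q} 0≤x x≈q = ≤-limit λ ε 0<ε →
    let M , lower = 0≤x (ε ℚ.* ½) (half-positive 0<ε)
        N , close = x≈q (ε ℚ.* ½) (half-positive 0<ε)
        i = M ℕ.⊔ N
    in begin
      0ℚ                                   ≤⟨ lower i (ℕ.m≤m⊔n M N) ⟩
      seq x i ℚ.+ ε ℚ.* ½                  ≤⟨ ℚ.+-monoˡ-≤ (ε ℚ.* ½) (∣-∣≤⇒≤+ {seq x i} {q} (close i (ℕ.m≤n⊔m M N))) ⟩
      q ℚ.+ ε ℚ.* ½ ℚ.+ ε ℚ.* ½            ≡⟨ ℚ.+-assoc q (ε ℚ.* ½) (ε ℚ.* ½) ⟩
      q ℚ.+ (ε ℚ.* ½ ℚ.+ ε ℚ.* ½)          ≡⟨ ≡.cong (q ℚ.+_) (halves ε) ⟩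
      q ℚ.+ ε                              ∎
    where open ℚ.≤-Reasoning

  ≈fromℚ⇒≤ : ∀ {x a b} → x ≈ fromℚ a → a ℚ.≤ b → x ≤ fromℚ b
  ≈fromℚ⇒≤ x≈a a≤b ε 0<ε = let N , close = x≈a ε 0<ε in
    N , λ i N≤i → ℚ.≤-trans (∣-∣≤⇒≤+ (close i N≤i)) (ℚ.+-monoˡ-≤ ε a≤b)

  fromℚ≤⇐≈ : ∀ {x a b} → x ≈ fromℚ a → b ℚ.≤ a → fromℚ b ≤ x
  fromℚ≤⇐≈ {x} {a} x≈a b≤a ε 0<ε = let N , close = ≈-sym {x} {fromℚ a} x≈a ε 0<ε in
    N , λ i N≤i → ℚ.≤-trans b≤a (∣-∣≤⇒≤+ (close i N≤i))

  -- Rational series over the reals as quotients of coefficient lists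

  private module ℝR = CommutativeRing realRing

  module RealSeries = Series realRing
  open RealSeries using (_⋆_; VanishesFrom; IsPolynomial; Rational; fraction)

  ⊛-⋆ : ∀ f g k → (f ⊛ g) k ≈ (f ⋆ g) k
  ⊛-⋆ f g k = begin
    (f ⊛ g) k           ≡⟨ ≡.cong sum (List.map-upTo (λ i → f i * g (k ℕ.∸ i)) (suc k)) ⟩
    convolution f g k   ≈⟨ convolution-⋆ f g k ⟩
    (f ⋆ g) k           ∎
    where
    open SetoidReasoning ℝR.setoid
    convolution : PowerSeries → PowerSeries → PowerSeries
    convolution f g k = sum (List.applyUpTo (λ i → f i * g (k ℕ.∸ i)) (suc k))
    convolution-⋆ : ∀ f g k → convolution f g k ≈ (f ⋆ g) k
    convolution-⋆ f g zero    = ℝR.+-identityʳ (f 0 * g 0)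
    convolution-⋆ f g (suc k) = +-cong {f 0 * g (suc k)} {f 0 * g (suc k)} {convolution (f ∘ suc) g k} {(f ∘ suc ⋆ g) k}
      (≈-refl {f 0 * g (suc k)}) (convolution-⋆ (f ∘ suc) g k)

  -- Cutting off at `N` loses nothing for a series that vanishes from `N` on.
  coefficients : ℕ → PowerSeries → List ℝ
  coefficients N f = List.applyUpTo f N

  polynomial-coefficients : ∀ N f → VanishesFrom N f → ∀ k → polynomial (coefficients N f) k ≈ f k
  polynomial-coefficients zero    f f≈0 k       = ≈-sym {f k} {0ℝ} (f≈0 k z≤n)
  polynomial-coefficients (suc N) f f≈0 zero    = ≈-refl {f 0}
  polynomial-coefficients (suc N) f f≈0 (suc k) = polynomial-coefficients N (f ∘ suc) (λ i N≤i → f≈0 (suc i) (s≤s N≤i)) k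

  rational⇒isRationalFunction : ∀ {f} → Rational f → IsRationalFunction f
  rational⇒isRationalFunction {f} (fraction {P} {Q} (N , P≈0) (M , Q≈0) Q₀ e) =
    num , den , (1ℝ , unit) , equation
    where
    open SetoidReasoning ℝR.setoid
    num = coefficients N P
    den = coefficients M Q
    unit : polynomial den 0 * 1ℝ ≈ 1ℝ
    unit = begin
      polynomial den 0 * 1ℝ   ≈⟨ ℝR.*-identityʳ (polynomial den 0) ⟩
      polynomial den 0        ≈⟨ polynomial-coefficients M Q Q≈0 0 ⟩
      Q 0                   ≈⟨ Q₀ ⟩
      1ℝ                    ∎
    equation : ∀ k → (f ⊛ polynomial den) k ≈ polynomial num k
    equation k = begin
      (f ⊛ polynomial den) k   ≈⟨ ⊛-⋆ f (polynomial den) k ⟩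
      (f ⋆ polynomial den) k   ≈⟨ RealSeries.⋆-cong {f} {f} {polynomial den} {Q} (λ i → ≈-refl {f i}) (polynomial-coefficients M Q Q≈0) k ⟩
      (f ⋆ Q) k              ≈⟨ e k ⟩
      P k                    ≈⟨ polynomial-coefficients N P P≈0 k ⟨
      polynomial num k         ∎

-- Rounds of the game

module Rounds (G : PileGame) where

  open PileGame G

  mover : ℕ → Player
  mover t = t ℕ.mod players

  after : ℕ → Chips → Fin m → Chips
  after t c i = updateAt c (mover t) (move i)

  wins : ℕ → Chips → Fin m → Bool
  wins t c i = does (target ℕ.≤? after t c i (mover t))

  mover-shift : ∀ t → mover (players ℕ.+ t) ≡ mover t
  mover-shift t = Fin.fromℕ<-cong _ _ (≡.trans (≡.cong (ℕ._% players) (ℕ.+-comm players t)) (ℕ.[m+n]%n≡m%n t players)) _ _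

  -- Positions are functions and are compared pointwise, so every construction on them has to be
  -- shown to respect `_≗_`.
  after-cong : ∀ t {c c′} → c ≗ c′ → ∀ i → after t c i ≗ after t c′ i
  after-cong t {c} {c′} c≗c′ i j with j Fin.≟ mover t
  ... | yes ≡.refl = ≡.trans (Vector.updateAt-updates (mover t) c)
                       (≡.trans (≡.cong (move i) (c≗c′ (mover t))) (≡.sym (Vector.updateAt-updates (mover t) c′)))
  ... | no j≢      = ≡.trans (Vector.updateAt-minimal j (mover t) c j≢)
                       (≡.trans (c≗c′ j) (≡.sym (Vector.updateAt-minimal j (mover t) c′ j≢)))

  wins-cong : ∀ t {c c′} → c ≗ c′ → ∀ i → wins t c i ≡ wins t c′ i
  wins-cong t c≗c′ i = ≡.cong (λ a → does (target ℕ.≤? a)) (after-cong t c≗c′ i (mover t))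

  InPlay : Chips → Set
  InPlay c = ∀ i → c i ℕ.< target

  inPlay-after : ∀ t c i → InPlay c → wins t c i ≡ false → InPlay (after t c i)
  inPlay-after t c i c< ¬win j with j Fin.≟ mover t
  ... | no j≢      = ≡.subst (ℕ._< target) (≡.sym (Vector.updateAt-minimal j (mover t) c j≢)) (c< j)
  ... | yes ≡.refl = ℕ.≰⇒> (does-false (target ℕ.≤? after t c i (mover t)) ¬win)
    where
    does-false : ∀ {P : Set} (P? : Dec P) → does P? ≡ false → ¬ P
    does-false (no ¬p) _ = ¬p

  instance
    target-nonZero : ℕ.NonZero target
    target-nonZero = ℕ.>-nonZero target≥1

  size : ℕ
  size = target ℕ.^ players

  -- Reduction modulo the target makes the encoding total; on positions in play it changes nothing,
  -- so these are numbered faithfully by the digits of a number below `size`.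
  encode : Chips → Fin size
  encode c = Fin.funToFin (λ i → c i ℕ.mod target)

  decode : Fin size → Chips
  decode d i = Fin.toℕ (Fin.finToFun d i)

  decode-encode : ∀ {c} → InPlay c → decode (encode c) ≗ c
  decode-encode {c} c< i = begin
    Fin.toℕ (Fin.finToFun (encode c) i) ≡⟨ ≡.cong Fin.toℕ (Fin.finToFun-funToFin (λ i → c i ℕ.mod target) i) ⟩
    Fin.toℕ (c i ℕ.mod target)          ≡⟨ Fin.toℕ-fromℕ< _ ⟩
    c i ℕ.% target                      ≡⟨ ℕ.m<n⇒m%n≡m (c< i) ⟩
    c i                                 ∎
    where open ≡.≡-Reasoning

  decode-inPlay : ∀ d → InPlay (decode d)
  decode-inPlay d i = Fin.toℕ<n (Fin.finToFun {target} {players} d i)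

  -- Expected payoffs over stretches of turns

  module Expectation (R : CommutativeRing 0ℓ 0ℓ) (w : Fin m → CommutativeRing.Carrier R) where

    open CommutativeRing R hiding (zero)
    open Sum semiring using (sum; sum-cong-≋; sum-replicate-zero; ∑-distrib-+; ∑-comm; *-distribˡ-sum; *-distribʳ-sum)
    open Series R using (constant)

    indicator : Bool → Carrier
    indicator b = if b then 1# else 0#

    -- Expected payoff over r turns starting with turn t in position c: g is paid
    -- on the final position if nobody has won, and h on the winning turn.
    expect : ℕ → ℕ → Chips → (Chips → Carrier) → (ℕ → Carrier) → Carrier
    expect zero    t c g h = g c
    expect (suc r) t c g h = sum λ i → w i * (if wins t c i then h t else expect r (suc t) (after t c i) g h)

    if-cong : ∀ {x x′ y y′} b → x ≈ x′ → y ≈ y′ → (if b then x else y) ≈ (if b then x′ else y′)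
    if-cong true  x≈ y≈ = x≈
    if-cong false x≈ y≈ = y≈

    -- Agreement of the turn payoffs is asked only on the turns actually played; this is what lets
    -- `round-payoff` evaluate them in the first round.
    expect-cong : ∀ r t {c c′ g g′ h h′} → c ≗ c′ → (∀ {c c′} → c ≗ c′ → g c ≈ g′ c′) →
      (∀ u → t ℕ.≤ u → u ℕ.< r ℕ.+ t → h u ≈ h′ u) → expect r t c g h ≈ expect r t c′ g′ h′
    expect-cong zero    t c≗ g≈ h≈ = g≈ c≗
    expect-cong (suc r) t {c} {c′} {g} {g′} {h} {h′} c≗ g≈ h≈ = sum-cong-≋ {m} λ i → *-congˡ (trans
      (if-cong (wins t c i) (h≈ t ℕ.≤-refl (s≤s (ℕ.m≤n+m t r)))
        (expect-cong r (suc t) {g = g} {g′} {h} {h′} (after-cong t c≗ i) g≈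
          (λ u t<u u< → h≈ u (ℕ.<⇒≤ t<u) (≡.subst (u ℕ.<_) (ℕ.+-suc r t) u<))))
      (reflexive (≡.cong (λ b → if b then h′ t else expect r (suc t) (after t c′ i) g′ h′) (wins-cong t c≗ i))))

    -- The Markov property: the later turns depend on the earlier ones only through the position
    -- reached.
    expect-split : ∀ r ℓ t c g h → expect (r ℕ.+ ℓ) t c g h ≈ expect r t c (λ c′ → expect ℓ (r ℕ.+ t) c′ g h) h
    expect-split zero    ℓ t c g h = refl
    expect-split (suc r) ℓ t c g h = sum-cong-≋ {m} λ i → *-congˡ (if-cong (wins t c i) refl (trans
      (expect-split r ℓ (suc t) (after t c i) g h)
      (reflexive (≡.cong (λ u → expect r (suc t) (after t c i) (λ c′ → expect ℓ u c′ g h) h) (ℕ.+-suc r t)))))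

    expect-shift : ∀ ℓ t c g h → expect ℓ (players ℕ.+ t) c g h ≈ expect ℓ t c g (h ∘ (players ℕ.+_))
    expect-shift zero    t c g h = refl
    expect-shift (suc ℓ) t c g h = sum-cong-≋ {m} λ i → *-congˡ (trans
      (reflexive (≡.cong (λ j → if does (target ℕ.≤? updateAt c j (move i) j) then h (players ℕ.+ t)
                                else expect ℓ (suc (players ℕ.+ t)) (updateAt c j (move i)) g h) (mover-shift t)))
      (if-cong (wins t c i) refl (trans
        (reflexive (≡.cong (λ u → expect ℓ u (after t c i) g h) (≡.sym (ℕ.+-suc players t))))
        (expect-shift ℓ (suc t) (after t c i) g h))))

    δ : Fin size → Chips → Carrier
    δ d c = indicator (does (encode c Fin.≟ d))

    sum-δ : ∀ n (e : Fin n) (f : Fin n → Carrier) → f e ≈ sum (λ d → indicator (does (e Fin.≟ d)) * f d)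
    sum-δ (suc n) zero    f = sym (trans (+-cong (*-identityˡ _)
      (trans (sum-cong-≋ {n} (λ d → zeroˡ _)) (sum-replicate-zero n))) (+-identityʳ _))
    sum-δ (suc n) (suc e) f = sym (trans (+-cong (zeroˡ _) (sym (sum-δ n e (f ∘ suc)))) (+-identityˡ _))

    zero-combination : ∀ n (f : Fin n → Carrier) x → x ≈ sum (λ d → 0# * f d) + x
    zero-combination n f x = sym (trans
      (+-congʳ (trans (sum-cong-≋ {n} (λ d → zeroˡ (f d))) (sum-replicate-zero n))) (+-identityˡ x))

    sum-linear : ∀ {n} (X : Fin m → Fin n → Carrier) (Y : Fin m → Carrier) (f : Fin n → Carrier) →
      sum (λ i → w i * (sum (λ d → X i d * f d) + Y i)) ≈
      sum (λ d → sum (λ i → w i * X i d) * f d) + sum (λ i → w i * Y i)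
    sum-linear {n} X Y f = begin
      sum (λ i → w i * (sum (λ d → X i d * f d) + Y i))
        ≈⟨ sum-cong-≋ {m} (λ i → trans (distribˡ _ _ _) (+-congʳ (trans (*-distribˡ-sum {n} (w i) (λ d → X i d * f d))
             (sum-cong-≋ {n} (λ d → sym (*-assoc (w i) (X i d) (f d))))))) ⟩
      sum (λ i → sum (λ d → w i * X i d * f d) + w i * Y i)
        ≈⟨ ∑-distrib-+ {m} (λ i → sum (λ d → w i * X i d * f d)) (λ i → w i * Y i) ⟩
      sum (λ i → sum (λ d → w i * X i d * f d)) + sum (λ i → w i * Y i)
        ≈⟨ +-congʳ (∑-comm {m} {n} (λ i d → w i * X i d * f d)) ⟩
      sum (λ d → sum (λ i → w i * X i d * f d)) + sum (λ i → w i * Y i)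
        ≈⟨ +-congʳ (sum-cong-≋ {n} (λ d → *-distribʳ-sum {m} (f d) (λ i → w i * X i d))) ⟨
      sum (λ d → sum (λ i → w i * X i d) * f d) + sum (λ i → w i * Y i) ∎
      where open SetoidReasoning setoid

    Respects≗ : (Chips → Carrier) → Set
    Respects≗ g = ∀ {c c′} → c ≗ c′ → g c ≈ g c′

    -- Paths without a winner stay in play, so they end in a position that is recovered from its
    -- code. There `g` is the combination of the `δ d` with coefficients `g (decode d)`, and
    -- expectation is linear.
    expect-linear : ∀ r t c g h → InPlay c → Respects≗ g → expect r t c g h ≈
      sum (λ d → expect r t c (δ d) (λ _ → 0#) * g (decode d)) + expect r t c (λ _ → 0#) h
    expect-linear zero    t c g h c< g-resp = trans (g-resp (λ i → ≡.sym (decode-encode c< i)))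
      (trans (sum-δ size (encode c) (g ∘ decode)) (sym (+-identityʳ _)))
    expect-linear (suc r) t c g h c< g-resp = trans
      (sum-cong-≋ {m} λ i → *-congˡ (step i (wins t c i) ≡.refl))
      (sum-linear {size}
        (λ i d → if wins t c i then 0# else expect r (suc t) (after t c i) (δ d) (λ _ → 0#))
        (λ i → if wins t c i then h t else expect r (suc t) (after t c i) (λ _ → 0#) h)
        (g ∘ decode))
      where
      step : ∀ i b → wins t c i ≡ b →
        (if b then h t else expect r (suc t) (after t c i) g h) ≈
        sum (λ d → (if b then 0# else expect r (suc t) (after t c i) (δ d) (λ _ → 0#)) * g (decode d)) +
        (if b then h t else expect r (suc t) (after t c i) (λ _ → 0#) h)
      step i true  _    = zero-combination size (g ∘ decode) (h t)
      step i false ¬win = expect-linear r (suc t) (after t c i) g h (inPlay-after t c i c< ¬win) g-resp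

    expect-zero : ∀ r t c → expect r t c (λ _ → 0#) (λ _ → 0#) ≈ 0#
    expect-zero zero    t c = refl
    expect-zero (suc r) t c = trans (sum-cong-≋ {m} (λ i → trans (*-congˡ (zeros (wins t c i) (expect-zero r (suc t) (after t c i)))) (zeroʳ (w i)))) (sum-replicate-zero m)
      where
      zeros : ∀ b {x} → x ≈ 0# → (if b then 0# else x) ≈ 0#
      zeros true  _   = refl
      zeros false x≈0 = x≈0

    expect-one : sum w ≈ 1# → ∀ r t c → expect r t c (λ _ → 1#) (λ _ → 1#) ≈ 1#
    expect-one Σw≈1 zero    t c = refl
    expect-one Σw≈1 (suc r) t c = trans (sum-cong-≋ {m} (λ i → trans (*-congˡ (ones (wins t c i) (expect-one Σw≈1 r (suc t) (after t c i)))) (*-identityʳ (w i)))) Σw≈1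
      where
      ones : ∀ b {x} → x ≈ 1# → (if b then 1# else x) ≈ 1#
      ones true  _   = refl
      ones false x≈1 = x≈1

    -- Winning probabilities of a set of players and their recurrence by rounds

    module Payoff (φ : Player → Bool) where

      payoff : ℕ → ℕ → Carrier
      payoff k t = indicator (φ (mover t) ∧ (suc (t ℕ./ players) ℕ.≡ᵇ k))

      winProbability : Chips → ℕ → Carrier
      winProbability c k = expect (k ℕ.* players) 0 c (λ _ → 0#) (payoff k)

      -- A full round later the same player moves and his own turn number is one higher.
      payoff-shift : ∀ k t → payoff (suc k) (players ℕ.+ t) ≡ payoff k t
      payoff-shift k t = ≡.cong₂ (λ j a → indicator (φ j ∧ (suc a ℕ.≡ᵇ suc k))) (mover-shift t)
        (≡.trans (ℕ.m/n≡1+[m∸n]/n (ℕ.m≤m+n players t)) (≡.cong (λ u → suc (u ℕ./ players)) (ℕ.m+n∸m≡n players t)))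

      winProbability-cong : ∀ {c c′} → c ≗ c′ → ∀ k → winProbability c k ≈ winProbability c′ k
      winProbability-cong c≗ k = expect-cong (k ℕ.* players) 0 c≗ (λ _ → refl) (λ _ _ _ → refl)

      transition : Fin size → Fin size → Carrier
      transition c d = expect players 0 (decode c) (δ d) (λ _ → 0#)

      firstRound : Fin size → Carrier
      firstRound c = expect players 0 (decode c) (λ _ → 0#) (indicator ∘ φ ∘ mover)

      payoff-firstRound : ∀ k t → t ℕ.< players → payoff (suc k) t ≡ indicator (φ (mover t) ∧ (0 ℕ.≡ᵇ k))
      payoff-firstRound k t t< = ≡.cong (λ a → indicator (φ (mover t) ∧ (suc a ℕ.≡ᵇ suc k))) (ℕ.m<n⇒m/n≡0 t<)

      -- Every win in the first round happens at the winner's own turn 1, so it contributes to the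
      -- coefficient of index 1 only.
      round-payoff : ∀ c k → expect players 0 (decode c) (λ _ → 0#) (payoff (suc k)) ≈ constant (firstRound c) k
      round-payoff c zero    = expect-cong players 0 (λ _ → ≡.refl) (λ _ → refl) (λ u _ u< → reflexive (≡.trans
        (payoff-firstRound 0 u (≡.subst (u ℕ.<_) (ℕ.+-identityʳ players) u<)) (≡.cong indicator (Bool.∧-identityʳ (φ (mover u))))))
      round-payoff c (suc k) = trans (expect-cong players 0 (λ _ → ≡.refl) (λ _ → refl) (λ u _ u< → reflexive (≡.trans
        (payoff-firstRound (suc k) u (≡.subst (u ℕ.<_) (ℕ.+-identityʳ players) u<)) (≡.cong indicator (Bool.∧-zeroʳ (φ (mover u)))))))
        (expect-zero players 0 (decode c))

      -- Conditions on the first round: it is either won, or ends undecided in some position `d`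
      -- from which the game restarts with one round fewer.
      recurrence : ∀ c k → winProbability (decode c) (suc k) ≈
        constant (firstRound c) k + sum (λ d → transition c d * winProbability (decode d) k)
      recurrence c k = begin
        winProbability (decode c) (suc k)
          ≈⟨ expect-split players (k ℕ.* players) 0 (decode c) (λ _ → 0#) (payoff (suc k)) ⟩
        expect players 0 (decode c) (λ c′ → expect (k ℕ.* players) (players ℕ.+ 0) c′ (λ _ → 0#) (payoff (suc k))) (payoff (suc k))
          ≈⟨ expect-cong players 0 (λ _ → ≡.refl) next (λ _ _ _ → refl) ⟩
        expect players 0 (decode c) (λ c′ → winProbability c′ k) (payoff (suc k))
          ≈⟨ expect-linear players 0 (decode c) (λ c′ → winProbability c′ k) (payoff (suc k)) (decode-inPlay c) (λ c≗ → winProbability-cong c≗ k) ⟩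
        sum (λ d → transition c d * winProbability (decode d) k) + expect players 0 (decode c) (λ _ → 0#) (payoff (suc k))
          ≈⟨ +-congˡ (round-payoff c k) ⟩
        sum (λ d → transition c d * winProbability (decode d) k) + constant (firstRound c) k
          ≈⟨ +-comm _ _ ⟩
        constant (firstRound c) k + sum (λ d → transition c d * winProbability (decode d) k) ∎
        where
        open SetoidReasoning setoid
        next : ∀ {c c′} → c ≗ c′ → expect (k ℕ.* players) (players ℕ.+ 0) c (λ _ → 0#) (payoff (suc k)) ≈ winProbability c′ k
        next {c} {c′} c≗ = trans (expect-shift (k ℕ.* players) 0 c (λ _ → 0#) (payoff (suc k)))
          (expect-cong (k ℕ.* players) 0 c≗ (λ _ → refl) (λ u _ _ → reflexive (payoff-shift k u)))

-- From weighted choice sequences to expectations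

module Sequences (G : PileGame) (R : CommutativeRing 0ℓ 0ℓ) (w : Fin (PileGame.m G) → CommutativeRing.Carrier R) where

  open PileGame G
  open CommutativeRing R hiding (zero)
  open SetoidReasoning setoid
  open Rounds G
  open Expectation R w
  module Σᴿ = Sum semiring

  listSum listProduct : List Carrier → Carrier
  listSum     = List.foldr _+_ 0#
  listProduct = List.foldr _*_ 1#

  listSum-++ : ∀ xs ys → listSum (xs List.++ ys) ≈ listSum xs + listSum ys
  listSum-++ []       ys = sym (+-identityˡ _)
  listSum-++ (x ∷ xs) ys = trans (+-congˡ (listSum-++ xs ys)) (sym (+-assoc _ _ _))

  listSum-cong : ∀ {A : Set} {f g : A → Carrier} → (∀ x → f x ≈ g x) → ∀ xs → listSum (List.map f xs) ≈ listSum (List.map g xs)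
  listSum-cong f≈g []       = refl
  listSum-cong f≈g (x ∷ xs) = +-cong (f≈g x) (listSum-cong f≈g xs)

  listSum-* : ∀ {A : Set} a (f : A → Carrier) xs → listSum (List.map (λ x → a * f x) xs) ≈ a * listSum (List.map f xs)
  listSum-* a f []       = sym (zeroʳ a)
  listSum-* a f (x ∷ xs) = trans (+-congˡ (listSum-* a f xs)) (sym (distribˡ _ _ _))

  listSum-tabulate : ∀ n (f : Fin n → Carrier) → listSum (List.tabulate f) ≡ Σᴿ.sum f
  listSum-tabulate zero    f = ≡.refl
  listSum-tabulate (suc n) f = ≡.cong (f zero +_) (listSum-tabulate n (f ∘ suc))

  listSum-allFin : ∀ n (f : Fin n → Carrier) → listSum (List.map f (List.allFin n)) ≡ Σᴿ.sum f
  listSum-allFin n f = ≡.trans (≡.cong listSum (List.map-tabulate id f)) (listSum-tabulate n f)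

  listSum-filter : ∀ {A : Set} {P : Pred A 0ℓ} (P? : Decidable P) (f : A → Carrier) xs →
    listSum (List.map f (List.filter P? xs)) ≈ listSum (List.map (λ x → indicator (does (P? x)) * f x) xs)
  listSum-filter P? f []       = refl
  listSum-filter P? f (x ∷ xs) with does (P? x)
  ... | true  = +-cong (sym (*-identityˡ _)) (listSum-filter P? f xs)
  ... | false = trans (listSum-filter P? f xs) (trans (sym (+-identityˡ _)) (+-congʳ (sym (zeroˡ _))))

  listSum-cartesian : ∀ {A B C : Set} (f : A → B → C) (g : C → Carrier) xs ys →
    listSum (List.map g (List.cartesianProductWith f xs ys)) ≈
    listSum (List.map (λ x → listSum (List.map (λ y → g (f x y)) ys)) xs)
  listSum-cartesian f g []       ys = refl
  listSum-cartesian f g (x ∷ xs) ys = begin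
    listSum (List.map g (List.map (f x) ys List.++ List.cartesianProductWith f xs ys))
      ≡⟨ ≡.cong listSum (List.map-++ g (List.map (f x) ys) _) ⟩
    listSum (List.map g (List.map (f x) ys) List.++ List.map g (List.cartesianProductWith f xs ys))
      ≈⟨ listSum-++ (List.map g (List.map (f x) ys)) _ ⟩
    listSum (List.map g (List.map (f x) ys)) + listSum (List.map g (List.cartesianProductWith f xs ys))
      ≈⟨ +-cong (reflexive (≡.cong listSum (≡.sym (List.map-∘ ys)))) (listSum-cartesian f g xs ys) ⟩
    listSum (List.map (λ y → g (f x y)) ys) + listSum (List.map (λ x → listSum (List.map (λ y → g (f x y)) ys)) xs) ∎

  weight : ∀ {ℓ} → Vec (Fin m) ℓ → Carrier
  weight ω = listProduct (List.map w (Vec.toList ω))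

  mass : ∀ {ℓ} → (Vec (Fin m) ℓ → Bool) → Carrier
  mass {ℓ} F = listSum (List.map (λ ω → indicator (F ω) * weight ω) (sequences ℓ))

  mass-cong : ∀ {ℓ} {F F′ : Vec (Fin m) ℓ → Bool} → F ≗ F′ → mass F ≈ mass F′
  mass-cong {ℓ} F≗F′ = listSum-cong (λ ω → reflexive (≡.cong (λ b → indicator b * weight ω) (F≗F′ ω))) (sequences ℓ)

  -- Conditions on the first choice, matching the recursion of `expect`.
  mass-suc : ∀ {ℓ} (F : Vec (Fin m) (suc ℓ) → Bool) → mass F ≈ Σᴿ.sum (λ i → w i * mass (λ ω → F (i ∷ ω)))
  mass-suc {ℓ} F = begin
    mass F
      ≈⟨ listSum-cartesian _∷_ (λ ω → indicator (F ω) * weight ω) (List.allFin m) (sequences ℓ) ⟩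
    listSum (List.map (λ i → listSum (List.map (λ ω → indicator (F (i ∷ ω)) * (w i * weight ω)) (sequences ℓ))) (List.allFin m))
      ≈⟨ listSum-cong (λ i → trans (listSum-cong (λ ω → swap (indicator (F (i ∷ ω))) (w i) (weight ω)) (sequences ℓ))
           (listSum-* (w i) (λ ω → indicator (F (i ∷ ω)) * weight ω) (sequences ℓ))) (List.allFin m) ⟩
    listSum (List.map (λ i → w i * mass (λ ω → F (i ∷ ω))) (List.allFin m))
      ≡⟨ listSum-allFin m (λ i → w i * mass (λ ω → F (i ∷ ω))) ⟩
    Σᴿ.sum (λ i → w i * mass (λ ω → F (i ∷ ω))) ∎
    where
    swap : ∀ x y z → x * (y * z) ≈ y * (x * z)
    swap x y z = trans (sym (*-assoc x y z)) (trans (*-congʳ (*-comm x y)) (*-assoc y x z))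

  outcome : (Player → Bool) → ℕ → Maybe (Player × ℕ) → Bool
  outcome φ k nothing         = false
  outcome φ k (just (j , k′)) = φ j ∧ (k′ ℕ.≡ᵇ k)

  module _ (Σw≈1 : Σᴿ.sum w ≈ 1#) where

    -- Once the game is decided, the remaining choices of a sequence have total weight 1.
    mass-constant : ∀ ℓ b → mass {ℓ} (λ _ → b) ≈ indicator b
    mass-constant zero    b = trans (+-identityʳ _) (*-identityʳ _)
    mass-constant (suc ℓ) b = begin
      mass {suc ℓ} (λ _ → b)                     ≈⟨ mass-suc {ℓ} (λ _ → b) ⟩
      Σᴿ.sum (λ i → w i * mass {ℓ} (λ _ → b))    ≈⟨ Σᴿ.sum-cong-≋ {m} (λ i → *-congˡ (mass-constant ℓ b)) ⟩
      Σᴿ.sum (λ i → w i * indicator b)           ≈⟨ Σᴿ.*-distribʳ-sum {m} (indicator b) w ⟨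
      Σᴿ.sum w * indicator b                     ≈⟨ *-congʳ Σw≈1 ⟩
      1# * indicator b                           ≈⟨ *-identityˡ _ ⟩
      indicator b                                ∎

    mass-outcome : ∀ φ k ℓ t c → mass {ℓ} (λ ω → outcome φ k (play t c ω)) ≈ expect ℓ t c (λ _ → 0#) (Payoff.payoff φ k)
    mass-outcome φ k zero    t c = trans (+-identityʳ _) (zeroˡ _)
    mass-outcome φ k (suc ℓ) t c = trans (mass-suc {ℓ} (λ ω → outcome φ k (play t c ω)))
      (Σᴿ.sum-cong-≋ {m} (λ i → *-congˡ (step i (wins t c i))))
      where
      step : ∀ i b → mass {ℓ} (λ ω → outcome φ k (if b then just (mover t , suc (t ℕ./ players)) else play (suc t) (after t c i) ω)) ≈
        (if b then Payoff.payoff φ k t else expect ℓ (suc t) (after t c i) (λ _ → 0#) (Payoff.payoff φ k))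
      step i true  = mass-constant ℓ _
      step i false = mass-outcome φ k ℓ (suc t) (after t c i)

    probability : ∀ {ℓ} {E : Pred (Vec (Fin m) ℓ) 0ℓ} (E? : Decidable E) φ k t c →
      (∀ ω → does (E? ω) ≡ outcome φ k (play t c ω)) →
      listSum (List.map weight (List.filter E? (sequences ℓ))) ≈ expect ℓ t c (λ _ → 0#) (Payoff.payoff φ k)
    probability {ℓ} E? φ k t c e = trans (listSum-filter E? weight (sequences ℓ))
      (trans (mass-cong e) (mass-outcome φ k ℓ t c))

-- Rational weights: the round matrix and its limit

module RationalWeights (G : PileGame) (q : Fin (PileGame.m G) → ℚ) (0≤q : ∀ i → 0ℚ ℚ.≤ q i)
  (Σq≡1 : Sum.sum (CommutativeRing.semiring ℚ.+-*-commutativeRing) q ≡ 1ℚ) where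

  open PileGame G
  open Rounds G
  open Expectation ℚ.+-*-commutativeRing q
  open Substochastic using (sum-mono; IsSubstochastic; partialSum)
  open Substochastic.Σℚ using (sum; sum-cong-≋)

  expect-mono : ∀ r t c {g g′ h h′} → (∀ c → g c ℚ.≤ g′ c) → (∀ u → h u ℚ.≤ h′ u) →
    expect r t c g h ℚ.≤ expect r t c g′ h′
  expect-mono zero    t c g≤ h≤ = g≤ c
  expect-mono (suc r) t c {g} {g′} {h} {h′} g≤ h≤ = sum-mono m λ i →
    ℚ.*-monoˡ-≤-nonNeg (q i) {{ℚ.nonNegative (0≤q i)}} (if-mono (wins t c i) (h≤ t) (expect-mono r (suc t) (after t c i) g≤ h≤))
    where
    if-mono : ∀ b {x x′ y y′} → x ℚ.≤ x′ → y ℚ.≤ y′ → (if b then x else y) ℚ.≤ (if b then x′ else y′)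
    if-mono true  x≤ y≤ = x≤
    if-mono false x≤ y≤ = y≤

  0≤indicator : ∀ b → 0ℚ ℚ.≤ indicator b
  0≤indicator true  = ℚ.<⇒≤ (ℚ.positive⁻¹ 1ℚ)
  0≤indicator false = ℚ.≤-refl

  indicator≤1 : ∀ b → indicator b ℚ.≤ 1ℚ
  indicator≤1 true  = ℚ.≤-refl
  indicator≤1 false = ℚ.<⇒≤ (ℚ.positive⁻¹ 1ℚ)

  expect-nonNegative : ∀ r t c {g h} → (∀ c → 0ℚ ℚ.≤ g c) → (∀ u → 0ℚ ℚ.≤ h u) → 0ℚ ℚ.≤ expect r t c g h
  expect-nonNegative r t c {g} {h} 0≤g 0≤h = ≡.subst (ℚ._≤ expect r t c g h) (expect-zero r t c) (expect-mono r t c 0≤g 0≤h)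

  module Limit (φ : Player → Bool) where

    open Payoff φ

    0≤transition : ∀ c d → 0ℚ ℚ.≤ transition c d
    0≤transition c d = expect-nonNegative players 0 (decode c) (λ c′ → 0≤indicator (does (encode c′ Fin.≟ d))) (λ _ → ℚ.≤-refl)

    0≤firstRound : ∀ c → 0ℚ ℚ.≤ firstRound c
    0≤firstRound c = expect-nonNegative players 0 (decode c) (λ _ → ℚ.≤-refl) (λ u → 0≤indicator (φ (mover u)))

    -- The left side is the expectation of paying 1 for an undecided round and 1 for a win by a
    -- chosen player. Paying 1 for every win can only increase it, and then the total is 1.
    row+firstRound≤1 : ∀ c → sum (transition c) ℚ.+ firstRound c ℚ.≤ 1ℚ
    row+firstRound≤1 c = begin
      sum (transition c) ℚ.+ firstRound c
        ≡⟨ ≡.cong (ℚ._+ firstRound c) (sum-cong-≋ {size} (λ d → ℚ.*-identityʳ (transition c d))) ⟨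
      sum (λ d → transition c d ℚ.* 1ℚ) ℚ.+ firstRound c
        ≡⟨ expect-linear players 0 (decode c) (λ _ → 1ℚ) (indicator ∘ φ ∘ mover) (decode-inPlay c) (λ _ → ≡.refl) ⟨
      expect players 0 (decode c) (λ _ → 1ℚ) (indicator ∘ φ ∘ mover)
        ≤⟨ expect-mono players 0 (decode c) (λ _ → ℚ.≤-refl) (λ u → indicator≤1 (φ (mover u))) ⟩
      expect players 0 (decode c) (λ _ → 1ℚ) (λ _ → 1ℚ)
        ≡⟨ expect-one Σq≡1 players 0 (decode c) ⟩
      1ℚ ∎
      where open ℚ.≤-Reasoning

    substochastic : IsSubstochastic transition
    substochastic = 0≤transition , λ c → ℚ.≤-trans
      (Substochastic.≤+ʳ (sum (transition c)) (0≤firstRound c)) (row+firstRound≤1 c)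

    open Substochastic.Convergence transition substochastic firstRound 0≤firstRound row+firstRound≤1

    limit : Fin size → ℚ
    limit = V

    convergent : ∀ {ε} → 0ℚ ℚ.< ε → ∀ c → ∃ λ N → ∀ K → N ℕ.≤ K →
      partialSum (winProbability (decode c)) K ℚ.≤ limit c × limit c ℚ.≤ partialSum (winProbability (decode c)) K ℚ.+ ε
    convergent = convergence (λ c → winProbability (decode c)) (λ _ → ≡.refl)
      -- With no turns played every winning probability is 0, so the transition term drops out.
      (λ c → ≡.trans (recurrence c 0) (≡.trans
        (≡.cong (firstRound c ℚ.+_) (Substochastic.sum-zero size (λ d → ℚ.*-zeroʳ (transition c d)))) (ℚ.+-identityʳ (firstRound c))))
      (λ c k → ≡.trans (recurrence c (suc k)) (ℚ.+-identityˡ _))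

-- Generating functions of the game with real weights

module RealGame (G : PileGame) where

  open import Defs hiding (Player; Chips; target; p; winningGF; losingGF)
  open PileGame G
  open Rounds G
  open Reals
  open RealSeries using (Rational; rational-cong; recurrence-rational)
  module Eᴿ = Expectation realRing p
  open Sequences G realRing p using (outcome; probability; listSum-allFin)
  private module Σᴿ = Sum (CommutativeRing.semiring realRing)

  Σp : Σᴿ.sum p ≈ 1ℝ
  Σp = ≡.subst (_≈ 1ℝ) (listSum-allFin m p) Σp≈1

  is other : Player → Player → Bool
  is j i    = does (i Fin.≟ j)
  other j i = not (does (i Fin.≟ j))

  wins-outcome : ∀ j k o → does (Maybe.≡-dec (Product.≡-dec Fin._≟_ ℕ._≟_) o (just (j , k))) ≡ outcome (is j) k o
  wins-outcome j k nothing = ≡.refl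
  wins-outcome j k (just (i , k′)) with i Fin.≟ j
  ... | no _       = ≡.refl
  ... | yes ≡.refl = ≡.refl

  -- The decision is a search over all players and does not reduce, so the two Booleans are compared
  -- through a logical equivalence.
  loses-outcome : ∀ s j k ω → does (losesAt? s j k ω) ≡ outcome (other j) k (play 0 s ω)
  loses-outcome s j k ω = does-⇔ (mk⇔ to (from (play 0 s ω) ≡.refl)) (losesAt? s j k ω) (T? _)
    where
    to : LosesAt s j k ω → Bool.T (outcome (other j) k (play 0 s ω))
    to (i , i≢j , e) with i Fin.≟ j in eq
    ... | yes i≡j = contradiction i≡j i≢j
    ... | no _ = ≡.subst (Bool.T ∘ outcome (other j) k) (≡.sym e)
      (≡.subst (λ d → Bool.T (not (does d) ∧ (k ℕ.≡ᵇ k))) (≡.sym eq) (ℕ.≡⇒≡ᵇ k k ≡.refl))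
    from : ∀ o → play 0 s ω ≡ o → Bool.T (outcome (other j) k o) → LosesAt s j k ω
    from (just (i , k′)) e t with i Fin.≟ j
    ... | no i≢j = i , i≢j , ≡.trans e (≡.cong (λ k → just (i , k)) (ℕ.≡ᵇ⇒≡ k′ k t))

  winningGF-expect : ∀ s j k → winningGF s j k ≈ Eᴿ.Payoff.winProbability (is j) s k
  winningGF-expect s j k = probability Σp (winsAt? s j k) (is j) k 0 s
    (λ ω → wins-outcome j k (play 0 s ω))

  losingGF-expect : ∀ s j k → losingGF s j k ≈ Eᴿ.Payoff.winProbability (other j) s k
  losingGF-expect s j k = probability Σp (losesAt? s j k) (other j) k 0 s (loses-outcome s j k)

  module _ (s : Chips) (s< : InPlay s) (φ : Player → Bool) (f : PowerSeries)
           (f≈ : ∀ k → f k ≈ Eᴿ.Payoff.winProbability φ s k) where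

    -- The recurrence concerns encoded positions; `s` agrees pointwise with one of them because
    -- nobody has reached the target yet.
    isRationalFunction : IsRationalFunction f
    isRationalFunction = rational⇒isRationalFunction (rational-cong {winProbability (decode (encode s))} {f}
      (λ k → ≈-trans {winProbability (decode (encode s)) k} {winProbability s k} {f k}
        (winProbability-cong (decode-encode s<) k) (≈-sym {f k} {winProbability s k} (f≈ k)))
      (recurrence-rational size transition firstRound (λ c → winProbability (decode c)) (λ _ → ≈-refl {0ℝ}) recurrence (encode s)))
      where open Eᴿ.Payoff φ

    module _ (p-rational : ∀ i → IsRationalNumber (p i)) where

      q : Fin m → ℚ
      q i = proj₁ (p-rational i)

      p≈q : ∀ i → p i ≈ fromℚ (q i)
      p≈q i = proj₂ (p-rational i)

      open Substochastic using (partialSum)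
      open Substochastic.Σℚ using () renaming (sum to sumℚ)
      module Eℚ = Expectation ℚ.+-*-commutativeRing q

      sum-fromℚ : ∀ n {x : Fin n → ℝ} {a : Fin n → ℚ} → (∀ i → x i ≈ fromℚ (a i)) → Σᴿ.sum x ≈ fromℚ (sumℚ a)
      sum-fromℚ zero    x≈a = ≈-refl {0ℝ}
      sum-fromℚ (suc n) {x} {a} x≈a = +-cong {x zero} {fromℚ (a zero)} {Σᴿ.sum (x ∘ suc)} {fromℚ (sumℚ (a ∘ suc))}
        (x≈a zero) (sum-fromℚ n (x≈a ∘ suc))

      -- Transfers the whole calculation to rationals, where order and equality are decidable and
      -- `transience` applies.
      expect-fromℚ : ∀ r t c {g g′ h h′} → (∀ c → g c ≈ fromℚ (g′ c)) → (∀ u → h u ≈ fromℚ (h′ u)) →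
        Eᴿ.expect r t c g h ≈ fromℚ (Eℚ.expect r t c g′ h′)
      expect-fromℚ zero    t c g≈ h≈ = g≈ c
      expect-fromℚ (suc r) t c {g} {g′} {h} {h′} g≈ h≈ = sum-fromℚ m λ i →
        *-cong {p i} {fromℚ (q i)} {if wins t c i then h t else Eᴿ.expect r (suc t) (after t c i) g h}
          {fromℚ (if wins t c i then h′ t else Eℚ.expect r (suc t) (after t c i) g′ h′)} (p≈q i)
          (if-fromℚ (wins t c i) (h≈ t) (expect-fromℚ r (suc t) (after t c i) g≈ h≈))
        where
        if-fromℚ : ∀ b {x a y a′} → x ≈ fromℚ a → y ≈ fromℚ a′ → (if b then x else y) ≈ fromℚ (if b then a else a′)
        if-fromℚ true  x≈ y≈ = x≈
        if-fromℚ false x≈ y≈ = y≈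

      Σq≡1 : sumℚ q ≡ 1ℚ
      Σq≡1 = fromℚ-injective (≈-trans {fromℚ (sumℚ q)} {Σᴿ.sum p} {1ℝ} (≈-sym {Σᴿ.sum p} {fromℚ (sumℚ q)} (sum-fromℚ m p≈q)) Σp)

      open RationalWeights G q (λ i → nonNegative-fromℚ {p i} {q i} (p≥0 i) (p≈q i)) Σq≡1
      open Limit φ using (limit; convergent)

      a : ℕ → ℚ
      a = Eℚ.Payoff.winProbability φ (decode (encode s))

      f≈a : ∀ k → f k ≈ fromℚ (a k)
      f≈a k = ≈-trans {f k} {Eᴿ.Payoff.winProbability φ s k} {fromℚ (a k)} (f≈ k)
        (≈-trans {Eᴿ.Payoff.winProbability φ s k} {Eᴿ.Payoff.winProbability φ (decode (encode s)) k} {fromℚ (a k)}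
          (Eᴿ.Payoff.winProbability-cong φ (λ i → ≡.sym (decode-encode s< i)) k)
          (expect-fromℚ (k ℕ.* players) 0 (decode (encode s)) (λ _ → ≈-refl {0ℝ}) (λ u → indicator-fromℚ (φ (mover u) ∧ (suc (u ℕ./ players) ℕ.≡ᵇ k)))))
        where
        indicator-fromℚ : ∀ b → Eᴿ.indicator b ≈ fromℚ (Eℚ.indicator b)
        indicator-fromℚ true  = ≈-refl {1ℝ}
        indicator-fromℚ false = ≈-refl {0ℝ}

      partialSum-fromℚ : ∀ K {x : ℕ → ℝ} {b} → (∀ k → x k ≈ fromℚ (b k)) → sum (List.map x (List.upTo K)) ≈ fromℚ (partialSum b K)
      partialSum-fromℚ K {x} {b} x≈b = ≡.subst (λ l → sum l ≈ fromℚ (partialSum b K)) (≡.sym (List.map-upTo x K)) (applied K x≈b)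
        where
        applied : ∀ K {x : ℕ → ℝ} {b} → (∀ k → x k ≈ fromℚ (b k)) → sum (List.applyUpTo x K) ≈ fromℚ (partialSum b K)
        applied zero    x≈b = ≈-refl {0ℝ}
        applied (suc K) {x} {b} x≈b = +-cong {x 0} {fromℚ (b 0)} {sum (List.applyUpTo (x ∘ suc) K)} {fromℚ (partialSum (b ∘ suc) K)}
          (x≈b 0) (applied K (x≈b ∘ suc))

      W : ℚ
      W = limit (encode s)

      sumsTo : f SumsTo fromℚ W
      sumsTo ε 0<ε =
        let N , bounds = convergent 0<ε (encode s)
        in N , λ K N≤K →
          let S≈ = partialSum-fromℚ K {f} {a} f≈a
              S = sum (List.map f (List.upTo K))
              lower , upper = bounds K N≤K
          -- The partial sums never exceed `W`, so the slack `ε` on this side is merely added.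
          in ≈fromℚ⇒≤ {S} {partialSum a K} {W ℚ.+ ε} S≈ (ℚ.≤-trans lower (Substochastic.≤+ʳ W (ℚ.<⇒≤ 0<ε)))
           , fromℚ≤⇐≈ {S + fromℚ ε} {partialSum a K ℚ.+ ε} {W}
               (+-cong {S} {fromℚ (partialSum a K)} {fromℚ ε} {fromℚ ε} S≈ (≈-refl {fromℚ ε})) upper

      rationalSum : ∃ λ L → f SumsTo L × IsRationalNumber L
      rationalSum = fromℚ W , sumsTo , W , ≈-refl {fromℚ W}

open import Data.Nat using (_<_)
open import Defs

theorem2 : (G : PileGame) (s : Chips G) → (∀ i → s i < target G) → (j : Player G) →
    (IsRationalFunction (winningGF G s j) × IsRationalFunction (losingGF G s j)) ×
    ((∀ i → IsRationalNumber (p G i)) →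
      (∃ λ W → winningGF G s j SumsTo W × IsRationalNumber W) ×
      (∃ λ L → losingGF G s j SumsTo L × IsRationalNumber L))
theorem2 G s s< j =
  ( isRationalFunction s s< (is j) (winningGF G s j) (winningGF-expect s j)
  , isRationalFunction s s< (other j) (losingGF G s j) (losingGF-expect s j)) ,
  λ p-rational →
    rationalSum s s< (is j) (winningGF G s j) (winningGF-expect s j) p-rational ,
    rationalSum s s< (other j) (losingGF G s j) (losingGF-expect s j) p-rational
  where open RealGame G using (is; other; isRationalFunction; rationalSum; winningGF-expect; losingGF-expect)
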